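{- Every $4$-dimensional grid is equitably $4$-list arborable.
   Context: $P_n$ denotes the path on $n$ vertices and $\square$ the Cartesian product. A $4$-dimensional grid is $P_{n_1}\square P_{n_2}\square P_{n_3}\square P_{n_4}$ with every $n_i\ge 2$. A $k$-uniform list assignment $L$ for $G$ assigns to each vertex $v$ a set $L(v)$ of exactly $k$ colours; an $L$-colouring is a map $c$ with $c(v)\in L(v)$; it is equitable if every colour class has at most $\lceil |V(G)|/k\rceil$ vertices. $G$ is equitably $k$-list arborable if for every $k$-uniform list assignment $L$ there is an equitable $L$-colouring of $G$ in which every colour class induces an acyclic subgraph. -}

module Defs where

open import Data.Nat using (ℕ; zero; suc; _+_; _*_; _∸_; _≤_; _≟_; NonZero)
open import Data.Nat.DivMod using (_/_)
open import Data.Fin using (Fin; toℕ; inject₁; fromℕ)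
open import Data.Product using (_×_; _,_; Σ)
open import Data.Sum using (_⊎_)
open import Data.List using (List; length; filter; allFin; cartesianProduct)
open import Data.List.Relation.Unary.Unique.Propositional using (Unique)
open import Data.List.Membership.Propositional using (_∈_)
open import Relation.Binary.PropositionalEquality using (_≡_)
open import Relation.Nullary using (¬_)
open import Function.Definitions using (Injective)

record Graph : Set₁ where
  field
    V     : Set
    Adj   : V → V → Set
    verts : List V

open Graph public

order : Graph → ℕ
order G = length (verts G)

Path : ℕ → Graph
Path n = record
  { V     = Fin n
  ; Adj   = λ i j → (suc (toℕ i) ≡ toℕ j) ⊎ (suc (toℕ j) ≡ toℕ i)
  ; verts = allFin n
  }

_□_ : Graph → Graph → Graph
G □ H = record
  { V     = V G × V H
  ; Adj   = λ { (a , b) (a' , b') → (Adj G a a' × b ≡ b') ⊎ (a ≡ a' × Adj H b b') }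
  ; verts = cartesianProduct (verts G) (verts H)
  }

infixr 6 _□_

Grid4 : ℕ → ℕ → ℕ → ℕ → Graph
Grid4 n₁ n₂ n₃ n₄ = Path n₁ □ Path n₂ □ Path n₃ □ Path n₄

Colour : Set
Colour = ℕ

IsUniformListAssignment : (G : Graph) → ℕ → (V G → List Colour) → Set
IsUniformListAssignment G k L = ∀ v → Unique (L v) × length (L v) ≡ k

IsLColouring : (G : Graph) → (V G → List Colour) → (V G → Colour) → Set
IsLColouring G L c = ∀ v → c v ∈ L v

classSize : (G : Graph) → (V G → Colour) → Colour → ℕ
classSize G c a = length (filter (λ v → c v ≟ a) (verts G))

ceilDiv : ℕ → (k : ℕ) → .{{_ : NonZero k}} → ℕ
ceilDiv n k = (n + (k ∸ 1)) / k

IsEquitable : (G : Graph) → (k : ℕ) → .{{_ : NonZero k}} → (V G → Colour) → Set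
IsEquitable G k c = ∀ a → classSize G c a ≤ ceilDiv (order G) k

record Cycle (G : Graph) : Set where
  field
    len    : ℕ
    vtx    : Fin (suc (suc (suc len))) → V G
    inj    : Injective _≡_ _≡_ vtx
    step   : ∀ (i : Fin (suc (suc len))) → Adj G (vtx (inject₁ i)) (vtx (Fin.suc i))
    close  : Adj G (vtx (fromℕ (suc (suc len)))) (vtx Fin.zero)

ClassesAcyclic : (G : Graph) → (V G → Colour) → Set
ClassesAcyclic G c = ∀ (a : Colour) (C : Cycle G) → ¬ (∀ i → c (Cycle.vtx C i) ≡ a)

EquitablyListArborable : Graph → (k : ℕ) → .{{_ : NonZero k}} → Set
EquitablyListArborable G k = ∀ (L : V G → List Colour) → IsUniformListAssignment G k L →
  Σ (V G → Colour) λ c → IsLColouring G L c × IsEquitable G k c × ClassesAcyclic G c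

{-# OPTIONS --safe #-}

-- The paths are cut into blocks {2t , 2t + 1}, the last block being a single vertex if the length is odd; a tile
-- is a product of four blocks. The tiles are coloured one after the other, those with large coordinates first, so
-- that a vertex has a coloured neighbour outside its tile only in the directions in which its coordinate is odd.
-- A colour is blocked for a vertex if two coloured neighbours already have it; if no blocked colour is ever used,
-- the last vertex of a monochromatic cycle cannot exist.
--
-- A tile of at least four vertices is partitioned into groups of four, and the vertices of a group receive
-- distinct colours, so each colour is used on at most a quarter of the tile. A group can be coloured greedily if
-- its members have at most 7, 5, 3 and 1 coloured neighbours outside the group. Tiles of 4 and 8 vertices have such
-- partitions. A tile of 16 vertices has none, but is coloured in a similar way once its first group is chosen with
-- care. In the tiles of at most two vertices a vertex has at most one earlier neighbour, so that nothing is ever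
-- blocked; these tiles are coloured beforehand, in groups of four distinct colours.
module Submission where

open import Defs
open import Data.Nat using (ℕ; _≤_)
open import Data.Bool using (Bool; true; false; not; _∧_; T; if_then_else_)
open import Data.Bool.Properties using (T?; T-≡; not-¬)
open import Data.Fin using (Fin; zero; suc; toℕ; inject₁; fromℕ)
open import Data.Fin.Patterns using (0F; 1F; 2F; 3F)
import Data.Fin.Properties as Fin
open import Data.Fin.Relation.Unary.Top using (view; ‵fromℕ; ‵inject₁)
open import Data.List using (List; []; _∷_; _++_; length; lookup; map; filter; tabulate; allFin; cartesianProduct)
open import Data.List.Properties
  using (filter-notAll; filter-accept; filter-reject; map-++; map-∘; map-tabulate; length-map)
open import Data.List.Membership.Propositional using (_∈_)
open import Data.List.Membership.Propositional.Properties using (∈-lookup)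
import Data.List.Membership.DecPropositional as DecMembership
open import Data.List.Relation.Unary.All as All using (All; []; _∷_)
import Data.List.Relation.Unary.All.Properties as All
open import Data.List.Relation.Unary.AllPairs using (AllPairs; []; _∷_; allPairs?)
open import Data.List.Relation.Unary.Any as Any using (Any; here; there; any?)
open import Data.List.Relation.Unary.Unique.Propositional using (Unique)
open import Data.List.Relation.Unary.Unique.Propositional.Properties using (allFin⁺; cartesianProduct⁺; filter⁺)
open import Data.Nat
  using (zero; suc; _+_; _*_; _∸_; _<_; z≤n; s≤s; _≟_; _<?_; _<ᵇ_; _≤ᵇ_; ⌊_/2⌋; ⌈_/2⌉)
open import Data.Nat.DivMod using (_/_; /-monoˡ-≤; m*n/n≡m)
open import Data.Nat.ListAction using (sum)
open import Data.Nat.ListAction.Properties using (sum-++)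
open import Data.Nat.Properties
open import Algebra.Properties.CommutativeSemigroup +-commutativeSemigroup using (interchange; xy∙z≈xz∙y)
open import Data.Nat.Solver using (module +-*-Solver)
open import Data.Product using (Σ; ∃; ∃₂; _×_; _,_; proj₁; proj₂)
open import Data.Product.Properties using (≡-dec)
open import Data.Sum using (_⊎_; inj₁; inj₂; swap)
open import Function using (_∘_; id)
open import Function.Bundles using (Equivalence)
open import Function.Definitions using (Injective)
open import Relation.Binary.Definitions using (DecidableEquality)
open import Relation.Binary.PropositionalEquality
open import Relation.Nullary using (¬_; yes; no; ¬?; contradiction; _×-dec_)
open import Relation.Nullary.Decidable using (does; True; toWitness; dec-true; dec-false; _→-dec_)

-- Choosing a colour

-- A coloured neighbour: its direction, whether it lies in the next tile, its colour.
Item : Set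
Item = (Fin 4 × Bool) × ℕ

AtMostOnce : ℕ → List Item → Set
AtMostOnce α = AllPairs (λ i j → proj₂ i ≡ α → proj₂ j ≢ α)

-- Two items of one colour must be the same entry. Tags tell the neighbours of a vertex apart, so
-- this is how two equally coloured earlier neighbours are later shown to coincide.
atMostOnce-unique : ∀ {α its i j} → AtMostOnce α its →
  (i , α) ∈ its → (j , α) ∈ its → i ≡ j
atMostOnce-unique (_ ∷ _) (here refl) (here refl) = refl
atMostOnce-unique (p ∷ _) (here refl) (there j)   = contradiction refl (All.lookup p j refl)
atMostOnce-unique (p ∷ _) (there i)   (here refl) = contradiction refl (All.lookup p i refl)
atMostOnce-unique (_ ∷ q) (there i)   (there j)   = atMostOnce-unique q i j

absent⇒atMostOnce : ∀ {α its} → All (λ i → α ≢ proj₂ i) its → AtMostOnce α its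
absent⇒atMostOnce []       = []
absent⇒atMostOnce (p ∷ ps) = All.map (λ _ e → contradiction (sym e) p) ps ∷ absent⇒atMostOnce ps

remove : ∀ {A : Set} → (A → ℕ) → ℕ → List A → List A
remove f α = filter (λ x → ¬? (α ≟ f x))

module _ {A : Set} (f : A → ℕ) (α : ℕ) where

  remove-hit : ∀ {x} xs → α ≡ f x → remove f α (x ∷ xs) ≡ remove f α xs
  remove-hit xs e = filter-reject (λ x → ¬? (α ≟ f x)) (λ n → n e)

  remove-miss : ∀ {x} xs → α ≢ f x → remove f α (x ∷ xs) ≡ x ∷ remove f α xs
  remove-miss xs n = filter-accept (λ x → ¬? (α ≟ f x)) n

  remove-shorter : ∀ xs → Any (λ x → α ≡ f x) xs → length (remove f α xs) < length xs
  remove-shorter xs p = filter-notAll (λ x → ¬? (α ≟ f x)) xs (Any.map (λ e n → n e) p)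

  unremove-All : ∀ {P : A → Set} xs → (∀ {x} → α ≡ f x → P x) → All P (remove f α xs) → All P xs
  unremove-All [] hit ps = []
  unremove-All {P} (x ∷ xs) hit ps with α ≟ f x
  ... | yes e = hit e ∷ unremove-All xs hit (subst (All P) (remove-hit xs e) ps)
  ... | no n with subst (All P) (remove-miss xs n) ps
  ...   | p ∷ ps′ = p ∷ unremove-All xs hit ps′

atMostOnce-or-twice : ∀ α its → AtMostOnce α its ⊎ 2 + length (remove proj₂ α its) ≤ length its
atMostOnce-or-twice α [] = inj₁ []
atMostOnce-or-twice α (i ∷ its) with α ≟ proj₂ i | any? (λ j → α ≟ proj₂ j) its
... | yes e | yes twice rewrite remove-hit proj₂ α {i} its e =
  inj₂ (s≤s (remove-shorter proj₂ α its twice))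
... | yes e | no once = inj₁ (All.map (λ n _ e → n (sym e)) absent ∷ absent⇒atMostOnce absent)
  where absent = All.¬Any⇒All¬ its once
... | no n | _ with atMostOnce-or-twice α its
...   | inj₁ p = inj₁ (All.universal (λ _ e → contradiction (sym e) n) its ∷ p)
...   | inj₂ p rewrite remove-miss proj₂ α {i} its n = inj₂ (s≤s p)

-- The deleted items all have colour `α`, so those of another colour `β` are unaffected.
unremove-atMostOnce : ∀ {α β} its → α ≢ β → AtMostOnce β (remove proj₂ α its) → AtMostOnce β its
unremove-atMostOnce [] α≢β p = []
unremove-atMostOnce {α} {β} (i ∷ its) α≢β p with α ≟ proj₂ i
... | yes refl = All.universal (λ _ e → contradiction e α≢β) its ∷
                 unremove-atMostOnce its α≢β (subst (AtMostOnce β) (remove-hit proj₂ α {i} its refl) p)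
... | no n with subst (AtMostOnce β) (remove-miss proj₂ α {i} its n) p
...   | q ∷ p′ = unremove-All proj₂ α its (λ { refl _ → α≢β }) q ∷ unremove-atMostOnce its α≢β p′

record Choice (L : List ℕ) (its : List Item) (F : List ℕ) : Set where
  constructor choice
  field
    colour  : ℕ
    allowed : colour ∈ L
    once    : AtMostOnce colour its
    fresh   : All (colour ≢_) F

open Choice public

-- A forbidden colour uses up either an entry of F or two entries of its.
choose : ∀ L its F → Unique L → length its + 2 * length F < 2 * length L → Choice L its F
choose (α ∷ L) its F (α∉L ∷ uL) bound with any? (α ≟_) F
... | yes α∈F = choice (colour r) (there (allowed r)) (once r)
                  (unremove-All id α F (λ { refl e → All.lookup α∉L (allowed r) (sym e) }) (fresh r))
  where
  F′ = remove id α F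
  open ≤-Reasoning
  bound′ : length its + 2 * length F′ < 2 * length L
  bound′ = +-cancelʳ-≤ 2 _ _ (begin
    suc (length its + 2 * length F′) + 2   ≡⟨ cong suc (+-assoc (length its) _ 2) ⟩
    suc (length its + (2 * length F′ + 2)) ≡⟨ cong (λ z → suc (length its + z)) (trans (+-comm _ 2) (sym (*-suc 2 (length F′)))) ⟩
    suc (length its + 2 * suc (length F′)) ≤⟨ s≤s (+-monoʳ-≤ (length its) (*-monoʳ-≤ 2 (remove-shorter id α F α∈F))) ⟩
    suc (length its + 2 * length F)        ≤⟨ bound ⟩
    2 * suc (length L)                     ≡⟨ trans (*-suc 2 (length L)) (+-comm 2 _) ⟩
    2 * length L + 2                       ∎)
  r = choose L its F′ uL bound′
... | no α∉F with atMostOnce-or-twice α its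
...   | inj₁ p = choice α (here refl) p (All.¬Any⇒All¬ F α∉F)
...   | inj₂ p = choice (colour r) (there (allowed r))
                   (unremove-atMostOnce its (All.lookup α∉L (allowed r)) (once r)) (fresh r)
  where
  its′ = remove proj₂ α its
  open ≤-Reasoning
  bound′ : length its′ + 2 * length F < 2 * length L
  bound′ = +-cancelˡ-≤ 2 _ _ (begin
    2 + suc (length its′ + 2 * length F) ≤⟨ s≤s (+-monoˡ-≤ (2 * length F) p) ⟩
    suc (length its + 2 * length F)      ≤⟨ bound ⟩
    2 * suc (length L)                   ≡⟨ *-suc 2 (length L) ⟩
    2 + 2 * length L                     ∎)
  r = choose L its′ F uL bound′

-- Tiles with four or eight vertices

ListOf4 : List ℕ → Set
ListOf4 L = Unique L × length L ≡ 4

-- The 8 is twice the number of colours in a list. The test is an implicit argument of type `True`,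
-- settled by evaluation when `n` and the length of `F` are numerals. With 0, 1, 2 or 3 forbidden
-- colours it admits up to 7, 5, 3 or 1 items.
choose-within : ∀ {L} → ListOf4 L → ∀ {its n} → length its ≤ n → ∀ F {_ : True (n + 2 * length F <? 8)} →
  Choice L its F
choose-within {L} (uL , len) {its} bound F {ok} = choose L its F uL
  (subst (λ l → length its + 2 * length F < 2 * l) (sym len)
    (≤-<-trans (+-monoˡ-≤ (2 * length F) bound) (toWitness ok)))

choose₄ : ∀ {L} → ListOf4 L → ∀ its F {_ : True (length its + 2 * length F <? 8)} → Choice L its F
choose₄ l its F {ok} = choose-within l {its} ≤-refl F {ok}

quad : ℕ → ℕ → ℕ → ℕ → Fin 4 → ℕ
quad w x y z 0F = w
quad w x y z 1F = x
quad w x y z 2F = y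
quad w x y z 3F = z

-- The hypotheses have the shape of the `fresh` fields of three successive choices, each avoiding
-- the colours chosen before it in the group.
quad-injective : ∀ {w x y z} → All (x ≢_) (w ∷ []) → All (y ≢_) (w ∷ x ∷ []) →
  All (z ≢_) (w ∷ x ∷ y ∷ []) → Injective _≡_ _≡_ (quad w x y z)
quad-injective (xw ∷ []) (yw ∷ yx ∷ []) (zw ∷ zx ∷ zy ∷ []) {i} {j} = go i j
  where
  go : ∀ i j → quad _ _ _ _ i ≡ quad _ _ _ _ j → i ≡ j
  go 0F 0F e = refl
  go 0F 1F e = contradiction (sym e) xw
  go 0F 2F e = contradiction (sym e) yw
  go 0F 3F e = contradiction (sym e) zw
  go 1F 0F e = contradiction e xw
  go 1F 1F e = refl
  go 1F 2F e = contradiction (sym e) yx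
  go 1F 3F e = contradiction (sym e) zx
  go 2F 0F e = contradiction e yw
  go 2F 1F e = contradiction e yx
  go 2F 2F e = refl
  go 2F 3F e = contradiction (sym e) zy
  go 3F 0F e = contradiction e zw
  go 3F 1F e = contradiction e zx
  go 3F 2F e = contradiction e zy
  go 3F 3F e = refl

-- A numerical indicator, so that class sizes become sums that can be regrouped.
[_≈_] : ℕ → ℕ → ℕ
[ x ≈ e ] = if does (x ≟ e) then 1 else 0

≈-yes : ∀ {x e} → x ≡ e → [ x ≈ e ] ≡ 1
≈-yes {x} {e} p = cong (λ b → if b then 1 else 0) (dec-true (x ≟ e) p)

≈-no : ∀ {x e} → x ≢ e → [ x ≈ e ] ≡ 0
≈-no {x} {e} n = cong (λ b → if b then 1 else 0) (dec-false (x ≟ e) n)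

sum₄ : (Fin 4 → ℕ) → ℕ
sum₄ f = f 0F + f 1F + f 2F + f 3F

sum₄-only : ∀ (f : Fin 4 → ℕ) i → f i ≤ 1 → (∀ j → j ≢ i → f j ≡ 0) → sum₄ f ≤ 1
sum₄-only f 0F p z rewrite z 1F (λ ()) | z 2F (λ ()) | z 3F (λ ()) | +-identityʳ (f 0F) | +-identityʳ (f 0F) | +-identityʳ (f 0F) = p
sum₄-only f 1F p z rewrite z 0F (λ ()) | z 2F (λ ()) | z 3F (λ ()) | +-identityʳ (f 1F) | +-identityʳ (f 1F) = p
sum₄-only f 2F p z rewrite z 0F (λ ()) | z 1F (λ ()) | z 3F (λ ()) | +-identityʳ (f 2F) = p
sum₄-only f 3F p z rewrite z 0F (λ ()) | z 1F (λ ()) | z 2F (λ ()) = p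

injective⇒rare : ∀ {χ : Fin 4 → ℕ} → Injective _≡_ _≡_ χ → ∀ e → sum₄ (λ s → [ χ s ≈ e ]) ≤ 1
injective⇒rare {χ} inj e with χ 0F ≟ e | χ 1F ≟ e | χ 2F ≟ e | χ 3F ≟ e
... | yes p | _ | _ | _ = sum₄-only (λ s → [ χ s ≈ e ]) 0F (≤-reflexive (≈-yes p)) λ j n → ≈-no λ q → n (inj (trans q (sym p)))
... | _ | yes p | _ | _ = sum₄-only (λ s → [ χ s ≈ e ]) 1F (≤-reflexive (≈-yes p)) λ j n → ≈-no λ q → n (inj (trans q (sym p)))
... | _ | _ | yes p | _ = sum₄-only (λ s → [ χ s ≈ e ]) 2F (≤-reflexive (≈-yes p)) λ j n → ≈-no λ q → n (inj (trans q (sym p)))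
... | _ | _ | _ | yes p = sum₄-only (λ s → [ χ s ≈ e ]) 3F (≤-reflexive (≈-yes p)) λ j n → ≈-no λ q → n (inj (trans q (sym p)))
... | no p | no q | no r | no t = ≤-trans (≤-reflexive
  (cong₂ _+_ (cong₂ _+_ (cong₂ _+_ (≈-no p) (≈-no q)) (≈-no r)) (≈-no t))) z≤n

cons-if : Bool → Item → List Item → List Item
cons-if true  i its = i ∷ its
cons-if false i its = its

-- In direction i, a vertex with bit q = false has a neighbour coloured o in the next tile; if the tile
-- has two layers in this direction (m = true) and the partner of the vertex in the tile, coloured f,
-- is earlier (e = true), it counts too.
look : Fin 4 → (m q : Bool) (o : ℕ) (e : Bool) (f : ℕ) → List Item → List Item
look i m q o e f its = cons-if (not q) ((i , true) , o) (cons-if (m ∧ e) ((i , false) , f) its)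

Square Cube : Set → Set
Square A = Bool → Bool → A
Cube A = Bool → Square A

-- The bit `true` marks the even coordinate of a block, which is the only one if there is a single
-- layer.
layers : Bool → (Bool → ℕ) → ℕ
layers true  f = f true + f false
layers false f = f true

-- The four vertices form one group, so no partner counts as earlier and the flags are `false`;
-- `injective` excludes partners of the same colour.
record SquareSolution (i j : Fin 4) (L : Square (List ℕ)) (o₁ o₂ : Square ℕ) : Set where
  field
    γ         : Square ℕ
    allowed   : ∀ a b → γ a b ∈ L a b
    acyclic   : ∀ a b → AtMostOnce (γ a b) (look i true a (o₁ a b) false (γ (not a) b)
                                           (look j true b (o₂ a b) false (γ a (not b)) []))
    injective : ∀ {a b a′ b′} → γ a b ≡ γ a′ b′ → (a , b) ≡ (a′ , b′)
    fair      : ∀ e → 4 * layers true (λ a → layers true (λ b → [ γ a b ≈ e ])) ≤ 4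

solve-square : ∀ i j L o₁ o₂ → (∀ a b → ListOf4 (L a b)) → SquareSolution i j L o₁ o₂
solve-square i j L o₁ o₂ l = record
  { γ = γ ; allowed = allowed′ ; acyclic = acyclic′
  ; injective = λ {a} {b} {a′} {b′} e → trans (sym (unslot-slot a b))
                 (trans (cong unslot (χ-injective e)) (unslot-slot a′ b′))
  ; fair = λ e → *-monoʳ-≤ 4 (≤-trans (≤-reflexive (rearrange [ χ 3F ≈ e ] [ χ 2F ≈ e ] [ χ 1F ≈ e ] [ χ 0F ≈ e ]))
                                      (injective⇒rare χ-injective e))
  }
  where
  c00 = choose₄ (l false false) (((i , true) , o₁ false false) ∷ ((j , true) , o₂ false false) ∷ []) []
  c01 = choose₄ (l false true) (((i , true) , o₁ false true) ∷ []) (colour c00 ∷ [])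
  c10 = choose₄ (l true false) (((j , true) , o₂ true false) ∷ []) (colour c00 ∷ colour c01 ∷ [])
  c11 = choose₄ (l true true) [] (colour c00 ∷ colour c01 ∷ colour c10 ∷ [])
  χ = quad (colour c00) (colour c01) (colour c10) (colour c11)
  χ-injective : Injective _≡_ _≡_ χ
  χ-injective = quad-injective (fresh c01) (fresh c10) (fresh c11)
  slot : Square (Fin 4)
  slot false false = 0F
  slot false true  = 1F
  slot true  false = 2F
  slot true  true  = 3F
  unslot : Fin 4 → Bool × Bool
  unslot 0F = false , false
  unslot 1F = false , true
  unslot 2F = true , false
  unslot 3F = true , true
  unslot-slot : ∀ a b → unslot (slot a b) ≡ (a , b)
  unslot-slot false false = refl
  unslot-slot false true  = refl
  unslot-slot true  false = refl
  unslot-slot true  true  = refl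
  γ : Square ℕ
  γ a b = χ (slot a b)
  allowed′ : ∀ a b → γ a b ∈ L a b
  allowed′ false false = allowed c00
  allowed′ false true  = allowed c01
  allowed′ true  false = allowed c10
  allowed′ true  true  = allowed c11
  acyclic′ : ∀ a b → AtMostOnce (γ a b) (look i true a (o₁ a b) false (γ (not a) b)
                                        (look j true b (o₂ a b) false (γ a (not b)) []))
  acyclic′ false false = once c00
  acyclic′ false true  = once c01
  acyclic′ true  false = once c10
  acyclic′ true  true  = once c11
  rearrange : ∀ z y x w → (z + y) + (x + w) ≡ w + x + y + z
  rearrange = +-*-Solver.solve 4 (λ z y x w → (z :+ y) :+ (x :+ w) := w :+ x :+ y :+ z) refl
    where open +-*-Solver

-- With bits written as digits, the groups in order of choice are 000, 010, 100, 011 and 001, 110,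
-- 101, 111. The coloured neighbours outside the group number 3, 2, 2, 1 and 4, 3, 2, 1, within the
-- greedy bounds.
time₃ : Cube ℕ
time₃ false false c     = if c then 1 else 0
time₃ false true  c     = 0
time₃ true  false false = 0
time₃ true  false true  = 1
time₃ true  true  c     = 1

look₃ : (i j k : Fin 4) (o₁ o₂ o₃ γ : Cube ℕ) → Cube (List Item)
look₃ i j k o₁ o₂ o₃ γ a b c =
  look i true a (o₁ a b c) (time₃ (not a) b c <ᵇ time₃ a b c) (γ (not a) b c)
  (look j true b (o₂ a b c) (time₃ a (not b) c <ᵇ time₃ a b c) (γ a (not b) c)
  (look k true c (o₃ a b c) (time₃ a b (not c) <ᵇ time₃ a b c) (γ a b (not c)) []))

record CubeSolution (i j k : Fin 4) (L : Cube (List ℕ)) (o₁ o₂ o₃ : Cube ℕ) : Set where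
  field
    γ         : Cube ℕ
    allowed   : ∀ a b c → γ a b c ∈ L a b c
    acyclic   : ∀ a b c → AtMostOnce (γ a b c) (look₃ i j k o₁ o₂ o₃ γ a b c)
    injective : ∀ {a b c a′ b′ c′} → time₃ a b c ≡ time₃ a′ b′ c′ → γ a b c ≡ γ a′ b′ c′ →
                (a , b , c) ≡ (a′ , b′ , c′)
    fair      : ∀ e → 4 * layers true (λ a → layers true (λ b → layers true (λ c → [ γ a b c ≈ e ]))) ≤ 8

solve-cube : ∀ i j k L o₁ o₂ o₃ → (∀ a b c → ListOf4 (L a b c)) → CubeSolution i j k L o₁ o₂ o₃
solve-cube i j k L o₁ o₂ o₃ l = record
  { γ = γ ; allowed = allowed′ ; acyclic = acyclic′ ; injective = injective′ ; fair = fair′ }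
  where
  out₁ out₂ out₃ : Cube Item
  out₁ a b c = (i , true) , o₁ a b c
  out₂ a b c = (j , true) , o₂ a b c
  out₃ a b c = (k , true) , o₃ a b c
  c000 = choose₄ (l false false false)
    (out₁ false false false ∷ out₂ false false false ∷ out₃ false false false ∷ []) []
  c010 = choose₄ (l false true false)
    (out₁ false true false ∷ out₃ false true false ∷ []) (colour c000 ∷ [])
  c100 = choose₄ (l true false false)
    (out₂ true false false ∷ out₃ true false false ∷ []) (colour c000 ∷ colour c010 ∷ [])
  c011 = choose₄ (l false true true)
    (out₁ false true true ∷ []) (colour c000 ∷ colour c010 ∷ colour c100 ∷ [])
  c001 = choose₄ (l false false true)
    (out₁ false false true ∷ out₂ false false true ∷ ((j , false) , colour c011) ∷ ((k , false) , colour c000) ∷ []) []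
  c110 = choose₄ (l true true false)
    (((i , false) , colour c010) ∷ ((j , false) , colour c100) ∷ out₃ true true false ∷ []) (colour c001 ∷ [])
  c101 = choose₄ (l true false true)
    (out₂ true false true ∷ ((k , false) , colour c100) ∷ []) (colour c001 ∷ colour c110 ∷ [])
  c111 = choose₄ (l true true true)
    (((i , false) , colour c011) ∷ []) (colour c001 ∷ colour c110 ∷ colour c101 ∷ [])
  -- Colours are indexed by group and position in the group. As `unslot` recovers the vertex from
  -- these two, injectivity within a group reduces to that of `quad`.
  χ : ℕ → Fin 4 → ℕ
  χ zero    = quad (colour c000) (colour c010) (colour c100) (colour c011)
  χ (suc _) = quad (colour c001) (colour c110) (colour c101) (colour c111)
  χ-injective : ∀ t → Injective _≡_ _≡_ (χ t)
  χ-injective zero    = quad-injective (fresh c010) (fresh c100) (fresh c011)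
  χ-injective (suc _) = quad-injective (fresh c110) (fresh c101) (fresh c111)
  slot : Cube (Fin 4)
  slot false false false = 0F
  slot false true  false = 1F
  slot true  false false = 2F
  slot false true  true  = 3F
  slot false false true  = 0F
  slot true  true  false = 1F
  slot true  false true  = 2F
  slot true  true  true  = 3F
  unslot : ℕ → Fin 4 → Bool × Bool × Bool
  unslot zero    0F = false , false , false
  unslot zero    1F = false , true  , false
  unslot zero    2F = true  , false , false
  unslot zero    3F = false , true  , true
  unslot (suc _) 0F = false , false , true
  unslot (suc _) 1F = true  , true  , false
  unslot (suc _) 2F = true  , false , true
  unslot (suc _) 3F = true  , true  , true
  unslot-slot : ∀ a b c → unslot (time₃ a b c) (slot a b c) ≡ (a , b , c)
  unslot-slot false false false = refl
  unslot-slot false true  false = refl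
  unslot-slot true  false false = refl
  unslot-slot false true  true  = refl
  unslot-slot false false true  = refl
  unslot-slot true  true  false = refl
  unslot-slot true  false true  = refl
  unslot-slot true  true  true  = refl
  γ : Cube ℕ
  γ a b c = χ (time₃ a b c) (slot a b c)
  allowed′ : ∀ a b c → γ a b c ∈ L a b c
  allowed′ false false false = allowed c000
  allowed′ false true  false = allowed c010
  allowed′ true  false false = allowed c100
  allowed′ false true  true  = allowed c011
  allowed′ false false true  = allowed c001
  allowed′ true  true  false = allowed c110
  allowed′ true  false true  = allowed c101
  allowed′ true  true  true  = allowed c111
  acyclic′ : ∀ a b c → AtMostOnce (γ a b c) (look₃ i j k o₁ o₂ o₃ γ a b c)
  acyclic′ false false false = once c000
  acyclic′ false true  false = once c010
  acyclic′ true  false false = once c100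
  acyclic′ false true  true  = once c011
  acyclic′ false false true  = once c001
  acyclic′ true  true  false = once c110
  acyclic′ true  false true  = once c101
  acyclic′ true  true  true  = once c111
  injective′ : ∀ {a b c a′ b′ c′} → time₃ a b c ≡ time₃ a′ b′ c′ → γ a b c ≡ γ a′ b′ c′ →
    (a , b , c) ≡ (a′ , b′ , c′)
  injective′ {a} {b} {c} {a′} {b′} {c′} t e = trans (sym (unslot-slot a b c)) (trans (cong₂ unslot t
    (χ-injective (time₃ a b c) (trans e (cong (λ z → χ z (slot a′ b′ c′)) (sym t))))) (unslot-slot a′ b′ c′))
  rearrange : ∀ p q r s t u v w → ((p + q) + (r + s)) + ((t + u) + (v + w)) ≡ (w + u + s + t) + (v + q + r + p)
  rearrange = +-*-Solver.solve 8 (λ p q r s t u v w →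
    ((p :+ q) :+ (r :+ s)) :+ ((t :+ u) :+ (v :+ w)) := (w :+ u :+ s :+ t) :+ (v :+ q :+ r :+ p)) refl
    where open +-*-Solver
  fair′ : ∀ e → 4 * layers true (λ a → layers true (λ b → layers true (λ c → [ γ a b c ≈ e ]))) ≤ 8
  -- Each of the two groups has at most one vertex of colour `e`, hence the 2.
  fair′ e = *-monoʳ-≤ 4 {y = 2} (≤-trans (≤-reflexive (rearrange [ γ true true true ≈ e ] [ γ true true false ≈ e ]
      [ γ true false true ≈ e ] [ γ true false false ≈ e ] [ γ false true true ≈ e ] [ γ false true false ≈ e ]
      [ γ false false true ≈ e ] [ γ false false false ≈ e ]))
    (+-mono-≤ (injective⇒rare (χ-injective 0) e) (injective⇒rare (χ-injective 1) e)))

-- Tiles with sixteen vertices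

at : ∀ {A : Set} {P : A → Set} {xs : List A} → (i : Fin (length xs)) → All P xs → P (lookup xs i)
at i ps = All.lookup ps (∈-lookup i)

-- This serves `y₃`, the last of its group, which has two earlier neighbours outside the group where
-- the greedy bound admits one.
two-differ : ∀ {α β β′ i j} → β ≢ β′ → AtMostOnce α ((i , β) ∷ (j , β′) ∷ [])
two-differ n = ((λ e f → n (trans e (sym f))) ∷ []) ∷ [] ∷ []

Tesseract : Set → Set
Tesseract A = Bool → Cube A

-- u₁, u₂, u₃ and y stand for the vertices u₁, u₂, u₃ and y₁ of solve-tesseract below. Of the five neighbours of z₁₄
-- coloured before it, two lie outside the tile and have the colours s and s′, the others are u₃, u₂ and y₁.
record FirstGroup (L₁ L₂ L₃ L₄ : List ℕ) (I₁ I₂ I₃ I₄ : List Item) (s s′ : ℕ) : Set where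
  field
    u₁ u₂ u₃ y  : ℕ
    allowed₁    : u₁ ∈ L₁
    allowed₂    : u₂ ∈ L₂
    allowed₃    : u₃ ∈ L₃
    allowed₄    : y ∈ L₄
    once₁       : AtMostOnce u₁ I₁
    once₂       : AtMostOnce u₂ I₂
    once₃       : AtMostOnce u₃ I₃
    once₄       : AtMostOnce y I₄
    distinct    : Injective _≡_ _≡_ (quad u₁ u₂ u₃ y)
    blocked     : ℕ
    unblocked   : ∀ {α a b c d e} → α ≢ blocked →
                  AtMostOnce α ((a , s) ∷ (b , u₃) ∷ (c , u₂) ∷ (d , s′) ∷ (e , y) ∷ [])

module _ {s s′ u₂ u₃ y α : ℕ} {a b c d e : Fin 4 × Bool} (u₂≢u₃ : u₂ ≢ u₃) (y≢u₂ : y ≢ u₂) (y≢u₃ : y ≢ u₃) where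

  private
    apart : ∀ {p q} → p ≢ q → p ≡ α → q ≢ α
    apart n e f = n (trans e (sym f))

  -- As `u₂`, `u₃` and `y` differ pairwise and `s` is neither `u₂` nor `u₃`, a repetition involves
  -- `s′` or is `s` = `y`, which the first hypothesis identifies with `s′`.
  unblocked-left : (y ≡ s → s ≡ s′) → All (s ≢_) (u₂ ∷ u₃ ∷ []) → α ≢ s′ →
    AtMostOnce α ((a , s) ∷ (b , u₃) ∷ (c , u₂) ∷ (d , s′) ∷ (e , y) ∷ [])
  unblocked-left sy (s2 ∷ s3 ∷ []) n =
    (apart s3 ∷ apart s2 ∷ (λ _ f → n (sym f)) ∷ (λ e f → n (trans (sym e) (sy (trans f (sym e))))) ∷ []) ∷
    (apart (u₂≢u₃ ∘ sym) ∷ (λ _ f → n (sym f)) ∷ apart (y≢u₃ ∘ sym) ∷ []) ∷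
    ((λ _ f → n (sym f)) ∷ apart (y≢u₂ ∘ sym) ∷ []) ∷ ((λ f → contradiction (sym f) n) ∷ []) ∷ [] ∷ []

  -- The colour `s′` and the three inner colours are now pairwise distinct, so only `s` can occur
  -- twice.
  unblocked-right : All (s′ ≢_) (y ∷ u₂ ∷ u₃ ∷ []) → α ≢ s →
    AtMostOnce α ((a , s) ∷ (b , u₃) ∷ (c , u₂) ∷ (d , s′) ∷ (e , y) ∷ [])
  unblocked-right (sy ∷ s2 ∷ s3 ∷ []) n =
    (absurd ∷ absurd ∷ absurd ∷ absurd ∷ []) ∷
    (apart (u₂≢u₃ ∘ sym) ∷ apart (s3 ∘ sym) ∷ apart (y≢u₃ ∘ sym) ∷ []) ∷
    (apart (s2 ∘ sym) ∷ apart (y≢u₂ ∘ sym) ∷ []) ∷ (apart sy ∷ []) ∷ [] ∷ []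
    where
    absurd : ∀ {A : Set} → s ≡ α → A
    absurd f = contradiction (sym f) n

-- As the colours of u₂, u₃ and y differ, it suffices that one of s and s′ is not among them.
first-group : ∀ {L₁ L₂ L₃ L₄ I₁ I₂ I₃ I₄} → ListOf4 L₁ → ListOf4 L₂ → ListOf4 L₃ → ListOf4 L₄ →
  length I₁ ≤ 3 → length I₂ ≤ 3 → length I₃ ≤ 3 → length I₄ ≤ 1 → ∀ s s′ →
  FirstGroup L₁ L₂ L₃ L₄ I₁ I₂ I₃ I₄ s s′
first-group {L₁} {I₁ = I₁} l₁ l₂ l₃ l₄ b₁ b₂ b₃ b₄ s s′
  with (DecMembership._∈?_ _≟_ s′ L₁) ×-dec allPairs? (λ i j → (proj₂ i ≟ s′) →-dec ¬? (proj₂ j ≟ s′)) I₁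
-- Spending `s′` on `u₁` forces the other three members to avoid it.
... | yes (s′∈L₁ , s′-once) = record
  { allowed₁ = s′∈L₁ ; allowed₂ = allowed c₂ ; allowed₃ = allowed c₃ ; allowed₄ = allowed c₄
  ; once₁ = s′-once ; once₂ = once c₂ ; once₃ = once c₃ ; once₄ = once c₄
  ; distinct = quad-injective (fresh c₂) (fresh c₃) (fresh c₄)
  ; unblocked = unblocked-right (at 1F (fresh c₃) ∘ sym) (at 1F (fresh c₄)) (at 2F (fresh c₄))
      ((at 0F (fresh c₄) ∘ sym) ∷ (at 0F (fresh c₂) ∘ sym) ∷ (at 0F (fresh c₃) ∘ sym) ∷ [])
  }
  where
  c₂ = choose-within l₂ b₂ (s′ ∷ [])
  c₃ = choose-within l₃ b₃ (s′ ∷ colour c₂ ∷ [])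
  c₄ = choose-within l₄ b₄ (s′ ∷ colour c₂ ∷ colour c₃ ∷ [])
-- If `u₁` cannot take `s′`, then `u₂` is made to avoid both outer colours and `u₃` to avoid `s`.
... | no s′-bad with choose-within l₂ b₂ (s ∷ s′ ∷ [])
...   | c₂ with choose-within l₃ b₃ (s ∷ colour c₂ ∷ [])
...     | c₃ with colour c₃ ≟ s′
...       | yes c₃≡s′ = record
  { allowed₁ = allowed c₁ ; allowed₂ = allowed c₂ ; allowed₃ = allowed c₃ ; allowed₄ = allowed c₄
  ; once₁ = once c₁ ; once₂ = once c₂ ; once₃ = once c₃ ; once₄ = once c₄
  ; distinct = quad-injective ((at 0F (fresh c₁) ∘ sym) ∷ [])
      -- `c₁` was not told to avoid `c₃`, but `c₃` is `s′`, which `u₁` cannot take. This lets `c₄`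
      -- avoid `s` and be chosen before `c₁`.
      ((λ e → s′-bad (subst (λ z → z ∈ L₁ × AtMostOnce z I₁) (trans (sym e) c₃≡s′) (allowed c₁ , once c₁))) ∷
       at 1F (fresh c₃) ∷ [])
      ((at 1F (fresh c₁) ∘ sym) ∷ at 1F (fresh c₄) ∷ at 2F (fresh c₄) ∷ [])
  ; unblocked = unblocked-left (at 1F (fresh c₃) ∘ sym) (at 1F (fresh c₄)) (at 2F (fresh c₄))
      (λ e → contradiction e (at 0F (fresh c₄))) ((at 0F (fresh c₂) ∘ sym) ∷ (at 0F (fresh c₃) ∘ sym) ∷ [])
  }
  where
  c₄ = choose-within l₄ b₄ (s ∷ colour c₂ ∷ colour c₃ ∷ [])
  c₁ = choose-within l₁ b₁ (colour c₂ ∷ colour c₄ ∷ [])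
...       | no c₃≢s′ = record
  { allowed₁ = allowed c₁ ; allowed₂ = allowed c₂ ; allowed₃ = allowed c₃ ; allowed₄ = allowed c₄
  ; once₁ = once c₁ ; once₂ = once c₂ ; once₃ = once c₃ ; once₄ = once c₄
  ; distinct = quad-injective ((at 0F (fresh c₁) ∘ sym) ∷ []) ((at 1F (fresh c₁) ∘ sym) ∷ at 1F (fresh c₃) ∷ [])
      (fresh c₄)
  ; blocked = proj₁ rest
  ; unblocked = proj₂ rest
  }
  where
  c₁ = choose-within l₁ b₁ (colour c₂ ∷ colour c₃ ∷ [])
  c₄ = choose-within l₄ b₄ (colour c₁ ∷ colour c₂ ∷ colour c₃ ∷ [])
  rest : Σ ℕ λ β → ∀ {α a b c d e} → α ≢ β → AtMostOnce α
    ((a , s) ∷ (b , colour c₃) ∷ (c , colour c₂) ∷ (d , s′) ∷ (e , colour c₄) ∷ [])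
  rest with colour c₄ ≟ s′
  ... | yes c₄≡s′ = s′ , unblocked-left (at 1F (fresh c₃) ∘ sym) (at 1F (fresh c₄)) (at 2F (fresh c₄))
    (λ e → trans (sym e) c₄≡s′) ((at 0F (fresh c₂) ∘ sym) ∷ (at 0F (fresh c₃) ∘ sym) ∷ [])
  ... | no c₄≢s′ = s , unblocked-right (at 1F (fresh c₃) ∘ sym) (at 1F (fresh c₄)) (at 2F (fresh c₄))
    ((c₄≢s′ ∘ sym) ∷ (at 1F (fresh c₂) ∘ sym) ∷ (c₃≢s′ ∘ sym) ∷ [])

-- The groups are numbered in the order in which they are coloured; `χ` in `solve-tesseract` lists
-- their members. Only two vertices exceed the greedy bounds: `z₁₄`, third in its group, with five
-- earlier neighbours outside it, and `y₃`, fourth in its group, with two.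
time₄ : Tesseract ℕ
time₄ true  true  true  true  = 3
time₄ false true  true  true  = 0
time₄ true  false true  true  = 1
time₄ true  true  false true  = 3
time₄ true  true  true  false = 2
time₄ false false true  true  = 1
time₄ false true  false true  = 3
time₄ false true  true  false = 2
time₄ true  false false true  = 3
time₄ true  false true  false = 2
time₄ true  true  false false = 2
time₄ true  false false false = 0
time₄ false true  false false = 0
time₄ false false true  false = 0
time₄ false false false true  = 1
time₄ false false false false = 1

look₄ : (o₁ o₂ o₃ o₄ γ : Tesseract ℕ) → Tesseract (List Item)
look₄ o₁ o₂ o₃ o₄ γ a b c d =
  look 0F true a (o₁ a b c d) (time₄ (not a) b c d <ᵇ time₄ a b c d) (γ (not a) b c d)
  (look 1F true b (o₂ a b c d) (time₄ a (not b) c d <ᵇ time₄ a b c d) (γ a (not b) c d)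
  (look 2F true c (o₃ a b c d) (time₄ a b (not c) d <ᵇ time₄ a b c d) (γ a b (not c) d)
  (look 3F true d (o₄ a b c d) (time₄ a b c (not d) <ᵇ time₄ a b c d) (γ a b c (not d)) [])))

record TesseractSolution (L : Tesseract (List ℕ)) (o₁ o₂ o₃ o₄ : Tesseract ℕ) : Set where
  field
    γ         : Tesseract ℕ
    allowed   : ∀ a b c d → γ a b c d ∈ L a b c d
    acyclic   : ∀ a b c d → AtMostOnce (γ a b c d) (look₄ o₁ o₂ o₃ o₄ γ a b c d)
    injective : ∀ {a b c d a′ b′ c′ d′} → time₄ a b c d ≡ time₄ a′ b′ c′ d′ → γ a b c d ≡ γ a′ b′ c′ d′ →
                (a , b , c , d) ≡ (a′ , b′ , c′ , d′)
    fair      : ∀ e → 4 * layers true (λ a → layers true (λ b → layers true (λ c → layers true (λ d →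
                  [ γ a b c d ≈ e ])))) ≤ 16

solve-tesseract : ∀ L o₁ o₂ o₃ o₄ → (∀ a b c d → ListOf4 (L a b c d)) → TesseractSolution L o₁ o₂ o₃ o₄
solve-tesseract L o₁ o₂ o₃ o₄ l = record
  { γ = γ ; allowed = allowed′ ; acyclic = acyclic′ ; injective = injective′ ; fair = fair′ }
  where
  out₁ out₂ out₃ out₄ : Tesseract Item
  out₁ a b c d = (0F , true) , o₁ a b c d
  out₂ a b c d = (1F , true) , o₂ a b c d
  out₃ a b c d = (2F , true) , o₃ a b c d
  out₄ a b c d = (3F , true) , o₄ a b c d
  in₁ in₂ in₃ in₄ : ℕ → Item
  in₁ α = (0F , false) , α
  in₂ α = (1F , false) , α
  in₃ α = (2F , false) , α
  in₄ α = (3F , false) , α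

  -- The indices of a vertex are the directions in which its bit is false, but for uᵢ, whose only true bit is the
  -- one in direction i. The bits of x are all true, those of o all false.
  D : FirstGroup _ _ _ _
    (out₂ true false false false ∷ out₃ true false false false ∷ out₄ true false false false ∷ [])
    (out₁ false true false false ∷ out₃ false true false false ∷ out₄ false true false false ∷ [])
    (out₁ false false true false ∷ out₂ false false true false ∷ out₄ false false true false ∷ [])
    (out₁ false true true true ∷ [])
    (o₁ false true true false) (o₄ false true true false)
  D = first-group (l true false false false) (l false true false false) (l false false true false)
        (l false true true true) ≤-refl ≤-refl ≤-refl ≤-refl _ _
  open FirstGroup D using (u₁; u₂; u₃) renaming (y to y₁)

  -- Seven items are the most that the greedy bound admits, so this vertex has to open its group.
  o = choose₄ (l false false false false)
    (out₁ false false false false ∷ in₁ u₁ ∷ out₂ false false false false ∷ in₂ u₂ ∷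
     out₃ false false false false ∷ in₃ u₃ ∷ out₄ false false false false ∷ []) []
  z₁₂ = choose₄ (l false false true true)
    (out₁ false false true true ∷ out₂ false false true true ∷ in₂ y₁ ∷ in₄ u₃ ∷ []) (colour o ∷ [])
  u₄ = choose₄ (l false false false true)
    (out₁ false false false true ∷ out₂ false false false true ∷ out₃ false false false true ∷ [])
    (colour o ∷ colour z₁₂ ∷ [])
  y₂ = choose₄ (l true false true true)
    (out₂ true false true true ∷ []) (colour o ∷ colour z₁₂ ∷ colour u₄ ∷ [])

  -- z₃₄ avoids the colour of the outer neighbour of y₃, so that the two of them block no colour for y₃.
  z₃₄ = choose₄ (l true true false false)
    (in₁ u₂ ∷ in₂ u₁ ∷ out₃ true true false false ∷ out₄ true true false false ∷ [])
    (o₃ true true false true ∷ [])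
  z₂₄ = choose₄ (l true false true false)
    (in₁ u₃ ∷ out₂ true false true false ∷ in₃ u₁ ∷ out₄ true false true false ∷ in₄ (colour y₂) ∷ [])
    (colour z₃₄ ∷ [])
  -- The five items are left to `FirstGroup.unblocked`; in their place the one blocked colour is
  -- forbidden.
  z₁₄ = choose₄ (l false true true false) [] (colour z₃₄ ∷ colour z₂₄ ∷ FirstGroup.blocked D ∷ [])
  y₄ = choose₄ (l true true true false)
    (out₄ true true true false ∷ []) (colour z₃₄ ∷ colour z₂₄ ∷ colour z₁₄ ∷ [])

  z₁₃ = choose₄ (l false true false true)
    (out₁ false true false true ∷ in₂ (colour u₄) ∷ out₃ false true false true ∷ in₃ y₁ ∷ in₄ u₂ ∷ []) []
  z₂₃ = choose₄ (l true false false true)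
    (in₁ (colour u₄) ∷ out₂ true false false true ∷ out₃ true false false true ∷ in₃ (colour y₂) ∷ in₄ u₁ ∷ [])
    (colour z₁₃ ∷ [])
  x = choose₄ (l true true true true)
    (in₁ y₁ ∷ in₂ (colour y₂) ∷ in₄ (colour y₄) ∷ []) (colour z₁₃ ∷ colour z₂₃ ∷ [])
  y₃ = choose₄ (l true true false true) [] (colour z₁₃ ∷ colour z₂₃ ∷ colour x ∷ [])

  χ : ℕ → Fin 4 → ℕ
  χ 0 = quad u₁ u₂ u₃ y₁
  χ 1 = quad (colour o) (colour z₁₂) (colour u₄) (colour y₂)
  χ 2 = quad (colour z₃₄) (colour z₂₄) (colour z₁₄) (colour y₄)
  χ (suc (suc (suc _))) = quad (colour z₁₃) (colour z₂₃) (colour x) (colour y₃)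
  χ-injective : ∀ t → Injective _≡_ _≡_ (χ t)
  χ-injective 0 = FirstGroup.distinct D
  χ-injective 1 = quad-injective (fresh z₁₂) (fresh u₄) (fresh y₂)
  -- The third entry of `fresh z₁₄` concerns the blocked colour, so only the first two are passed
  -- on.
  χ-injective 2 = quad-injective (fresh z₂₄) (at 0F (fresh z₁₄) ∷ at 1F (fresh z₁₄) ∷ []) (fresh y₄)
  χ-injective (suc (suc (suc _))) = quad-injective (fresh z₂₃) (fresh x) (fresh y₃)
  slot : Tesseract (Fin 4)
  slot true  false false false = 0F
  slot false true  false false = 1F
  slot false false true  false = 2F
  slot false true  true  true  = 3F
  slot false false false false = 0F
  slot false false true  true  = 1F
  slot false false false true  = 2F
  slot true  false true  true  = 3F
  slot true  true  false false = 0F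
  slot true  false true  false = 1F
  slot false true  true  false = 2F
  slot true  true  true  false = 3F
  slot false true  false true  = 0F
  slot true  false false true  = 1F
  slot true  true  true  true  = 2F
  slot true  true  false true  = 3F
  unslot : ℕ → Fin 4 → Bool × Bool × Bool × Bool
  unslot 0 0F = true  , false , false , false
  unslot 0 1F = false , true  , false , false
  unslot 0 2F = false , false , true  , false
  unslot 0 3F = false , true  , true  , true
  unslot 1 0F = false , false , false , false
  unslot 1 1F = false , false , true  , true
  unslot 1 2F = false , false , false , true
  unslot 1 3F = true  , false , true  , true
  unslot 2 0F = true  , true  , false , false
  unslot 2 1F = true  , false , true  , false
  unslot 2 2F = false , true  , true  , false
  unslot 2 3F = true  , true  , true  , false
  unslot _ 0F = false , true  , false , true
  unslot _ 1F = true  , false , false , true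
  unslot _ 2F = true  , true  , true  , true
  unslot _ 3F = true  , true  , false , true
  unslot-slot : ∀ a b c d → unslot (time₄ a b c d) (slot a b c d) ≡ (a , b , c , d)
  unslot-slot true  true  true  true  = refl
  unslot-slot true  true  true  false = refl
  unslot-slot true  true  false true  = refl
  unslot-slot true  true  false false = refl
  unslot-slot true  false true  true  = refl
  unslot-slot true  false true  false = refl
  unslot-slot true  false false true  = refl
  unslot-slot true  false false false = refl
  unslot-slot false true  true  true  = refl
  unslot-slot false true  true  false = refl
  unslot-slot false true  false true  = refl
  unslot-slot false true  false false = refl
  unslot-slot false false true  true  = refl
  unslot-slot false false true  false = refl
  unslot-slot false false false true  = refl
  unslot-slot false false false false = refl
  γ : Tesseract ℕ
  γ a b c d = χ (time₄ a b c d) (slot a b c d)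
  allowed′ : ∀ a b c d → γ a b c d ∈ L a b c d
  allowed′ true  true  true  true  = allowed x
  allowed′ true  true  true  false = allowed y₄
  allowed′ true  true  false true  = allowed y₃
  allowed′ true  true  false false = allowed z₃₄
  allowed′ true  false true  true  = allowed y₂
  allowed′ true  false true  false = allowed z₂₄
  allowed′ true  false false true  = allowed z₂₃
  allowed′ true  false false false = FirstGroup.allowed₁ D
  allowed′ false true  true  true  = FirstGroup.allowed₄ D
  allowed′ false true  true  false = allowed z₁₄
  allowed′ false true  false true  = allowed z₁₃
  allowed′ false true  false false = FirstGroup.allowed₂ D
  allowed′ false false true  true  = allowed z₁₂
  allowed′ false false true  false = FirstGroup.allowed₃ D
  allowed′ false false false true  = allowed u₄
  allowed′ false false false false = allowed o
  acyclic′ : ∀ a b c d → AtMostOnce (γ a b c d) (look₄ o₁ o₂ o₃ o₄ γ a b c d)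
  acyclic′ true  true  true  true  = once x
  acyclic′ true  true  true  false = once y₄
  acyclic′ true  true  false true  = two-differ (at 0F (fresh z₃₄) ∘ sym)
  acyclic′ true  true  false false = once z₃₄
  acyclic′ true  false true  true  = once y₂
  acyclic′ true  false true  false = once z₂₄
  acyclic′ true  false false true  = once z₂₃
  acyclic′ true  false false false = FirstGroup.once₁ D
  acyclic′ false true  true  true  = FirstGroup.once₄ D
  acyclic′ false true  true  false = FirstGroup.unblocked D (at 2F (fresh z₁₄))
  acyclic′ false true  false true  = once z₁₃
  acyclic′ false true  false false = FirstGroup.once₂ D
  acyclic′ false false true  true  = once z₁₂
  acyclic′ false false true  false = FirstGroup.once₃ D
  acyclic′ false false false true  = once u₄
  acyclic′ false false false false = once o
  injective′ : ∀ {a b c d a′ b′ c′ d′} → time₄ a b c d ≡ time₄ a′ b′ c′ d′ → γ a b c d ≡ γ a′ b′ c′ d′ →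
    (a , b , c , d) ≡ (a′ , b′ , c′ , d′)
  injective′ {a} {b} {c} {d} {a′} {b′} {c′} {d′} t e = trans (sym (unslot-slot a b c d)) (trans (cong₂ unslot t
    (χ-injective (time₄ a b c d) (trans e (cong (λ z → χ z (slot a′ b′ c′ d′)) (sym t)))))
    (unslot-slot a′ b′ c′ d′))
  rearrange : ∀ p q r s t u v w p′ q′ r′ s′ t′ u′ v′ w′ → ((((p + q) + (r + s)) + ((t + u) + (v + w))) + (((p′ + q′) + (r′ + s′)) + ((t′ + u′) + (v′ + w′)))) ≡ ((w + s′ + u′ + p′) + (w′ + t′ + v′ + t)) + ((s + u + q′ + q) + (r′ + v + p + r))
  rearrange = +-*-Solver.solve 16 (λ p q r s t u v w p′ q′ r′ s′ t′ u′ v′ w′ → ((((p :+ q) :+ (r :+ s)) :+ ((t :+ u) :+ (v :+ w))) :+ (((p′ :+ q′) :+ (r′ :+ s′)) :+ ((t′ :+ u′) :+ (v′ :+ w′)))) := ((w :+ s′ :+ u′ :+ p′) :+ (w′ :+ t′ :+ v′ :+ t)) :+ ((s :+ u :+ q′ :+ q) :+ (r′ :+ v :+ p :+ r))) refl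
    where open +-*-Solver
  fair′ : ∀ e → 4 * layers true (λ a → layers true (λ b → layers true (λ c → layers true (λ d →
    [ γ a b c d ≈ e ])))) ≤ 16
  fair′ e = *-monoʳ-≤ 4 {y = 4} (≤-trans (≤-reflexive (rearrange
      [ γ true true true true ≈ e ] [ γ true true true false ≈ e ] [ γ true true false true ≈ e ] [ γ true true false false ≈ e ]
      [ γ true false true true ≈ e ] [ γ true false true false ≈ e ] [ γ true false false true ≈ e ] [ γ true false false false ≈ e ]
      [ γ false true true true ≈ e ] [ γ false true true false ≈ e ] [ γ false true false true ≈ e ] [ γ false true false false ≈ e ]
      [ γ false false true true ≈ e ] [ γ false false true false ≈ e ] [ γ false false false true ≈ e ] [ γ false false false false ≈ e ]))
    (+-mono-≤ (+-mono-≤ (injective⇒rare (χ-injective 0) e) (injective⇒rare (χ-injective 1) e))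
              (+-mono-≤ (injective⇒rare (χ-injective 2) e) (injective⇒rare (χ-injective 3) e))))

-- Tiles of any shape

-- The bits q that occur in a direction with two layers (m = true) or one.
data Real : Bool → Bool → Set where
  high : ∀ {m} → Real m true
  low  : Real true false

-- In an edge the odd vertex comes first: its only earlier neighbour can be the one outside the
-- tile, and that of the even vertex is its partner.
time₁ : Bool → ℕ
time₁ a = if a then 1 else 0

time : (m₁ m₂ m₃ m₄ : Bool) → Tesseract ℕ
time true  true  true  true  a b c d = time₄ a b c d
time true  true  true  false a b c _ = time₃ a b c
time true  true  false true  a b _ d = time₃ a b d
time true  true  false false _ _ _ _ = 0
time true  false true  true  a _ c d = time₃ a c d
time true  false true  false _ _ _ _ = 0
time true  false false true  _ _ _ _ = 0
time true  false false false a _ _ _ = time₁ a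
time false true  true  true  _ b c d = time₃ b c d
time false true  true  false _ _ _ _ = 0
time false true  false true  _ _ _ _ = 0
time false true  false false _ b _ _ = time₁ b
time false false true  true  _ _ _ _ = 0
time false false true  false _ _ c _ = time₁ c
time false false false true  _ _ _ d = time₁ d
time false false false false _ _ _ _ = 0

-- At most one direction has two layers: these are the tiles that keep the colouring k given beforehand.
few : (m₁ m₂ m₃ m₄ : Bool) → Bool
few true  true  _     _     = false
few true  false true  _     = false
few true  false false m₄    = not m₄
few false true  true  _     = false
few false true  false m₄    = not m₄
few false false true  m₄    = not m₄
few false false false _     = true

-- Bits of absent layers carry junk, hence the `Real` premises. A single vertex or an edge is too
-- small for each colour to take at most a quarter of it, so it has `kept` in place of `fair`.
record TileSolution (m₁ m₂ m₃ m₄ : Bool) (L : Tesseract (List ℕ)) (o₁ o₂ o₃ o₄ k : Tesseract ℕ) : Set where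
  field
    γ         : Tesseract ℕ
    allowed   : ∀ {a b c d} → Real m₁ a → Real m₂ b → Real m₃ c → Real m₄ d → γ a b c d ∈ L a b c d
    acyclic   : ∀ {a b c d} → Real m₁ a → Real m₂ b → Real m₃ c → Real m₄ d → AtMostOnce (γ a b c d)
      (look 0F m₁ a (o₁ a b c d) (time m₁ m₂ m₃ m₄ (not a) b c d <ᵇ time m₁ m₂ m₃ m₄ a b c d) (γ (not a) b c d)
      (look 1F m₂ b (o₂ a b c d) (time m₁ m₂ m₃ m₄ a (not b) c d <ᵇ time m₁ m₂ m₃ m₄ a b c d) (γ a (not b) c d)
      (look 2F m₃ c (o₃ a b c d) (time m₁ m₂ m₃ m₄ a b (not c) d <ᵇ time m₁ m₂ m₃ m₄ a b c d) (γ a b (not c) d)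
      (look 3F m₄ d (o₄ a b c d) (time m₁ m₂ m₃ m₄ a b c (not d) <ᵇ time m₁ m₂ m₃ m₄ a b c d) (γ a b c (not d)) []))))
    injective : ∀ {a b c d a′ b′ c′ d′} → Real m₁ a → Real m₂ b → Real m₃ c → Real m₄ d →
      Real m₁ a′ → Real m₂ b′ → Real m₃ c′ → Real m₄ d′ →
      time m₁ m₂ m₃ m₄ a b c d ≡ time m₁ m₂ m₃ m₄ a′ b′ c′ d′ → γ a b c d ≡ γ a′ b′ c′ d′ →
      (a , b , c , d) ≡ (a′ , b′ , c′ , d′)
    kept      : few m₁ m₂ m₃ m₄ ≡ true → ∀ {a b c d} → Real m₁ a → Real m₂ b → Real m₃ c → Real m₄ d →
      γ a b c d ≡ k a b c d
    fair      : few m₁ m₂ m₃ m₄ ≡ false → ∀ e →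
      4 * layers m₁ (λ a → layers m₂ (λ b → layers m₃ (λ c → layers m₄ (λ d → [ γ a b c d ≈ e ])))) ≤
      layers m₁ (λ _ → layers m₂ (λ _ → layers m₃ (λ _ → layers m₄ (λ _ → 1))))

time₁-injective : ∀ {a a′} → time₁ a ≡ time₁ a′ → a ≡ a′
time₁-injective {true}  {true}  _ = refl
time₁-injective {false} {false} _ = refl

solve-tile : ∀ m₁ m₂ m₃ m₄ L o₁ o₂ o₃ o₄ k → (∀ a b c d → ListOf4 (L a b c d)) → (∀ a b c d → k a b c d ∈ L a b c d) →
  TileSolution m₁ m₂ m₃ m₄ L o₁ o₂ o₃ o₄ k
solve-tile true  true  true  true  L o₁ o₂ o₃ o₄ k l _ = record
  { γ = λ a b c d → TesseractSolution.γ s a b c d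
  ; allowed = λ { _ _ _ _ → TesseractSolution.allowed s _ _ _ _ }
  ; acyclic = λ { {a} {b} {c} {d} _ _ _ _ → TesseractSolution.acyclic s a b c d }
  ; injective = λ { _ _ _ _ _ _ _ _ t e → TesseractSolution.injective s t e }
  ; kept = λ () ; fair = λ _ → TesseractSolution.fair s }
  where s = solve-tesseract L o₁ o₂ o₃ o₄ l
solve-tile true  true  true  false L o₁ o₂ o₃ o₄ k l _ = record
  { γ = λ a b c _ → CubeSolution.γ s a b c
  ; allowed = λ { _ _ _ high → CubeSolution.allowed s _ _ _ }
  ; acyclic = λ { {a} {b} {c} {_} _ _ _ high → CubeSolution.acyclic s a b c }
  ; injective = λ { _ _ _ high _ _ _ high t e → cong (λ (a , b , c) → (a , b , c , true)) (CubeSolution.injective s t e) }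
  ; kept = λ () ; fair = λ _ → CubeSolution.fair s }
  -- The absent direction is fixed at its only real bit, `true`.
  where s = solve-cube 0F 1F 2F (λ a b c → L a b c true) (λ a b c → o₁ a b c true) (λ a b c → o₂ a b c true)
            (λ a b c → o₃ a b c true) (λ a b c → l a b c true)
solve-tile true  true  false true  L o₁ o₂ o₃ o₄ k l _ = record
  { γ = λ a b _ d → CubeSolution.γ s a b d
  ; allowed = λ { _ _ high _ → CubeSolution.allowed s _ _ _ }
  ; acyclic = λ { {a} {b} {_} {d} _ _ high _ → CubeSolution.acyclic s a b d }
  ; injective = λ { _ _ high _ _ _ high _ t e → cong (λ (a , b , d) → (a , b , true , d)) (CubeSolution.injective s t e) }
  ; kept = λ () ; fair = λ _ → CubeSolution.fair s }
  where s = solve-cube 0F 1F 3F (λ a b d → L a b true d) (λ a b d → o₁ a b true d) (λ a b d → o₂ a b true d)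
            (λ a b d → o₄ a b true d) (λ a b d → l a b true d)
solve-tile true  true  false false L o₁ o₂ o₃ o₄ k l _ = record
  { γ = λ a b _ _ → SquareSolution.γ s a b
  ; allowed = λ { _ _ high high → SquareSolution.allowed s _ _ }
  ; acyclic = λ { {a} {b} {_} {_} _ _ high high → SquareSolution.acyclic s a b }
  ; injective = λ { _ _ high high _ _ high high _ e → cong (λ (a , b) → (a , b , true , true)) (SquareSolution.injective s e) }
  ; kept = λ () ; fair = λ _ → SquareSolution.fair s }
  where s = solve-square 0F 1F (λ a b → L a b true true) (λ a b → o₁ a b true true) (λ a b → o₂ a b true true)
            (λ a b → l a b true true)
solve-tile true  false true  true  L o₁ o₂ o₃ o₄ k l _ = record
  { γ = λ a _ c d → CubeSolution.γ s a c d
  ; allowed = λ { _ high _ _ → CubeSolution.allowed s _ _ _ }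
  ; acyclic = λ { {a} {_} {c} {d} _ high _ _ → CubeSolution.acyclic s a c d }
  ; injective = λ { _ high _ _ _ high _ _ t e → cong (λ (a , c , d) → (a , true , c , d)) (CubeSolution.injective s t e) }
  ; kept = λ () ; fair = λ _ → CubeSolution.fair s }
  where s = solve-cube 0F 2F 3F (λ a c d → L a true c d) (λ a c d → o₁ a true c d) (λ a c d → o₃ a true c d)
            (λ a c d → o₄ a true c d) (λ a c d → l a true c d)
solve-tile true  false true  false L o₁ o₂ o₃ o₄ k l _ = record
  { γ = λ a _ c _ → SquareSolution.γ s a c
  ; allowed = λ { _ high _ high → SquareSolution.allowed s _ _ }
  ; acyclic = λ { {a} {_} {c} {_} _ high _ high → SquareSolution.acyclic s a c }
  ; injective = λ { _ high _ high _ high _ high _ e → cong (λ (a , c) → (a , true , c , true)) (SquareSolution.injective s e) }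
  ; kept = λ () ; fair = λ _ → SquareSolution.fair s }
  where s = solve-square 0F 2F (λ a c → L a true c true) (λ a c → o₁ a true c true) (λ a c → o₃ a true c true)
            (λ a c → l a true c true)
solve-tile true  false false true  L o₁ o₂ o₃ o₄ k l _ = record
  { γ = λ a _ _ d → SquareSolution.γ s a d
  ; allowed = λ { _ high high _ → SquareSolution.allowed s _ _ }
  ; acyclic = λ { {a} {_} {_} {d} _ high high _ → SquareSolution.acyclic s a d }
  ; injective = λ { _ high high _ _ high high _ _ e → cong (λ (a , d) → (a , true , true , d)) (SquareSolution.injective s e) }
  ; kept = λ () ; fair = λ _ → SquareSolution.fair s }
  where s = solve-square 0F 3F (λ a d → L a true true d) (λ a d → o₁ a true true d) (λ a d → o₄ a true true d)
            (λ a d → l a true true d)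
solve-tile true  false false false L o₁ o₂ o₃ o₄ k _ k∈L = record
  { γ = k ; allowed = λ _ _ _ _ → k∈L _ _ _ _
  -- Either bit yields one item, the partner or the outer neighbour, so nothing is blocked.
  ; acyclic = λ { high high high high → [] ∷ [] ; low high high high → [] ∷ [] }
  ; injective = λ { _ high high high _ high high high t _ → cong (λ z → (z , true , true , true)) (time₁-injective t) }
  ; kept = λ _ _ _ _ _ → refl ; fair = λ () }
solve-tile false true  true  true  L o₁ o₂ o₃ o₄ k l _ = record
  { γ = λ _ b c d → CubeSolution.γ s b c d
  ; allowed = λ { high _ _ _ → CubeSolution.allowed s _ _ _ }
  ; acyclic = λ { {_} {b} {c} {d} high _ _ _ → CubeSolution.acyclic s b c d }
  ; injective = λ { high _ _ _ high _ _ _ t e → cong (λ (b , c , d) → (true , b , c , d)) (CubeSolution.injective s t e) }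
  ; kept = λ () ; fair = λ _ → CubeSolution.fair s }
  where s = solve-cube 1F 2F 3F (λ b c d → L true b c d) (λ b c d → o₂ true b c d) (λ b c d → o₃ true b c d)
            (λ b c d → o₄ true b c d) (λ b c d → l true b c d)
solve-tile false true  true  false L o₁ o₂ o₃ o₄ k l _ = record
  { γ = λ _ b c _ → SquareSolution.γ s b c
  ; allowed = λ { high _ _ high → SquareSolution.allowed s _ _ }
  ; acyclic = λ { {_} {b} {c} {_} high _ _ high → SquareSolution.acyclic s b c }
  ; injective = λ { high _ _ high high _ _ high _ e → cong (λ (b , c) → (true , b , c , true)) (SquareSolution.injective s e) }
  ; kept = λ () ; fair = λ _ → SquareSolution.fair s }
  where s = solve-square 1F 2F (λ b c → L true b c true) (λ b c → o₂ true b c true) (λ b c → o₃ true b c true)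
            (λ b c → l true b c true)
solve-tile false true  false true  L o₁ o₂ o₃ o₄ k l _ = record
  { γ = λ _ b _ d → SquareSolution.γ s b d
  ; allowed = λ { high _ high _ → SquareSolution.allowed s _ _ }
  ; acyclic = λ { {_} {b} {_} {d} high _ high _ → SquareSolution.acyclic s b d }
  ; injective = λ { high _ high _ high _ high _ _ e → cong (λ (b , d) → (true , b , true , d)) (SquareSolution.injective s e) }
  ; kept = λ () ; fair = λ _ → SquareSolution.fair s }
  where s = solve-square 1F 3F (λ b d → L true b true d) (λ b d → o₂ true b true d) (λ b d → o₄ true b true d)
            (λ b d → l true b true d)
solve-tile false true  false false L o₁ o₂ o₃ o₄ k _ k∈L = record
  { γ = k ; allowed = λ _ _ _ _ → k∈L _ _ _ _
  ; acyclic = λ { high high high high → [] ∷ [] ; high low high high → [] ∷ [] }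
  ; injective = λ { high _ high high high _ high high t _ → cong (λ z → (true , z , true , true)) (time₁-injective t) }
  ; kept = λ _ _ _ _ _ → refl ; fair = λ () }
solve-tile false false true  true  L o₁ o₂ o₃ o₄ k l _ = record
  { γ = λ _ _ c d → SquareSolution.γ s c d
  ; allowed = λ { high high _ _ → SquareSolution.allowed s _ _ }
  ; acyclic = λ { {_} {_} {c} {d} high high _ _ → SquareSolution.acyclic s c d }
  ; injective = λ { high high _ _ high high _ _ _ e → cong (λ (c , d) → (true , true , c , d)) (SquareSolution.injective s e) }
  ; kept = λ () ; fair = λ _ → SquareSolution.fair s }
  where s = solve-square 2F 3F (λ c d → L true true c d) (λ c d → o₃ true true c d) (λ c d → o₄ true true c d)
            (λ c d → l true true c d)
solve-tile false false true  false L o₁ o₂ o₃ o₄ k _ k∈L = record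
  { γ = k ; allowed = λ _ _ _ _ → k∈L _ _ _ _
  ; acyclic = λ { high high high high → [] ∷ [] ; high high low high → [] ∷ [] }
  ; injective = λ { high high _ high high high _ high t _ → cong (λ z → (true , true , z , true)) (time₁-injective t) }
  ; kept = λ _ _ _ _ _ → refl ; fair = λ () }
solve-tile false false false true  L o₁ o₂ o₃ o₄ k _ k∈L = record
  { γ = k ; allowed = λ _ _ _ _ → k∈L _ _ _ _
  ; acyclic = λ { high high high high → [] ∷ [] ; high high high low → [] ∷ [] }
  ; injective = λ { high high high _ high high high _ t _ → cong (λ z → (true , true , true , z)) (time₁-injective t) }
  ; kept = λ _ _ _ _ _ → refl ; fair = λ () }
solve-tile false false false false L o₁ o₂ o₃ o₄ k _ k∈L = record
  { γ = k ; allowed = λ _ _ _ _ → k∈L _ _ _ _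
  ; acyclic = λ { high high high high → [] }
  ; injective = λ { high high high high high high high high t _ → refl }
  ; kept = λ _ _ _ _ _ → refl ; fair = λ () }

-- Colouring the grid

even : ℕ → Bool
even 0             = true
even 1             = false
even (suc (suc x)) = even x

place : ℕ → Bool → ℕ
place zero    q = if q then 0 else 1
place (suc t) q = suc (suc (place t q))

place-halves : ∀ x → place ⌊ x /2⌋ (even x) ≡ x
place-halves 0             = refl
place-halves 1             = refl
place-halves (suc (suc x)) = cong (2 +_) (place-halves x)

half-place : ∀ t q → ⌊ place t q /2⌋ ≡ t
half-place zero    true  = refl
half-place zero    false = refl
half-place (suc t) q     = cong suc (half-place t q)

even-place : ∀ t q → even (place t q) ≡ q
even-place zero    true  = refl
even-place zero    false = refl
even-place (suc t) q     = even-place t q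

both : ∀ {m} → m ≡ true → ∀ q → Real m q
both refl true  = high
both refl false = low

layered : ℕ → ℕ → Bool
layered n t = place t false <ᵇ n

<⇒<ᵇ≡true : ∀ {m n} → m < n → (m <ᵇ n) ≡ true
<⇒<ᵇ≡true = Equivalence.to T-≡ ∘ <⇒<ᵇ

real : ∀ {n} x → x < n → Real (layered n ⌊ x /2⌋) (even x)
real 0 _ = high
real 1 x<n rewrite <⇒<ᵇ≡true x<n = low
real (suc (suc x)) (s≤s (s≤s x<n)) = real x x<n

buddy : ℕ → ℕ
buddy 0             = 1
buddy 1             = 0
buddy (suc (suc x)) = suc (suc (buddy x))

-- A step along a path leads to the next block, to the other vertex of the block or to the previous
-- block. The equations are those needed to rewrite tile coordinates and bits.
data Move (n x y : ℕ) : Set where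
  outward : even x ≡ false → y ≡ suc x → ⌊ y /2⌋ ≡ suc ⌊ x /2⌋ → even y ≡ true → Move n x y
  across  : layered n ⌊ x /2⌋ ≡ true → y ≡ buddy x → ⌊ y /2⌋ ≡ ⌊ x /2⌋ → even y ≡ not (even x) → Move n x y
  back    : ⌊ x /2⌋ ≡ suc ⌊ y /2⌋ → Move n x y

move-shift : ∀ {n x y} → Move n x y → Move (suc (suc n)) (suc (suc x)) (suc (suc y))
move-shift (outward a b c d) = outward a (cong (2 +_) b) (cong suc c) d
move-shift (across a b c d)  = across a (cong (2 +_) b) (cong suc c) d
move-shift (back a)          = back (cong suc a)

-- Blocks repeat with period two, so both coordinates can be lowered by two; what remains are the
-- steps among 0, 1 and 2.
move : ∀ {n} x y → x < n → y < n → (suc x ≡ y) ⊎ (suc y ≡ x) → Move n x y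
move 0 1 _ y<n _ = across (<⇒<ᵇ≡true y<n) refl refl refl
move 1 0 x<n _ _ = across (<⇒<ᵇ≡true x<n) refl refl refl
move 1 2 _ _ _ = outward refl refl refl refl
move 2 1 _ _ _ = back refl
move (suc (suc x)) (suc (suc y)) (s≤s (s≤s x<n)) (s≤s (s≤s y<n)) (inj₁ e) =
  move-shift (move x y x<n y<n (inj₁ (suc-injective (suc-injective e))))
move (suc (suc x)) (suc (suc y)) (s≤s (s≤s x<n)) (s≤s (s≤s y<n)) (inj₂ e) =
  move-shift (move x y x<n y<n (inj₂ (suc-injective (suc-injective e))))
move 0 0 _ _ (inj₁ ())
move 0 0 _ _ (inj₂ ())
move 0 (suc (suc _)) _ _ (inj₁ ())
move 0 (suc (suc _)) _ _ (inj₂ ())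
move (suc (suc _)) 0 _ _ (inj₁ ())
move (suc (suc _)) 0 _ _ (inj₂ ())
move 1 1 _ _ (inj₁ ())
move 1 1 _ _ (inj₂ ())
move 1 (suc (suc (suc _))) _ _ (inj₁ ())
move 1 (suc (suc (suc _))) _ _ (inj₂ ())
move (suc (suc (suc _))) 1 _ _ (inj₁ ())
move (suc (suc (suc _))) 1 _ _ (inj₂ ())

module _ {i : Fin 4} (m q : Bool) {o : ℕ} {e : Bool} {f : ℕ} {its : List Item} where

  private
    ∈-cons-if : ∀ b {x i its} → x ∈ its → x ∈ cons-if b i its
    ∈-cons-if true  p = there p
    ∈-cons-if false p = p

  look-further : ∀ {x} → x ∈ its → x ∈ look i m q o e f its
  look-further p = ∈-cons-if (not q) (∈-cons-if (m ∧ e) p)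

  look-outward : q ≡ false → ((i , true) , o) ∈ look i m q o e f its
  look-outward refl = here refl

  look-across : m ≡ true → e ≡ true → ((i , false) , f) ∈ look i m q o e f its
  look-across refl refl = ∈-cons-if (not q) (here refl)

-- Bounds on the times

time₁≤3 : ∀ a → time₁ a ≤ 3
time₁≤3 true  = s≤s z≤n
time₁≤3 false = z≤n

time₃≤3 : ∀ a b c → time₃ a b c ≤ 3
time₃≤3 false false c     = time₁≤3 c
time₃≤3 false true  c     = z≤n
time₃≤3 true  false false = z≤n
time₃≤3 true  false true  = s≤s z≤n
time₃≤3 true  true  c     = s≤s z≤n

time₄≤3 : ∀ a b c d → time₄ a b c d ≤ 3
time₄≤3 a b c d = ≤ᵇ⇒≤ _ _ (table a b c d)
  where
  table : ∀ a b c d → T (time₄ a b c d ≤ᵇ 3)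
  table true  true  true  true  = _
  table true  true  true  false = _
  table true  true  false true  = _
  table true  true  false false = _
  table true  false true  true  = _
  table true  false true  false = _
  table true  false false true  = _
  table true  false false false = _
  table false true  true  true  = _
  table false true  true  false = _
  table false true  false true  = _
  table false true  false false = _
  table false false true  true  = _
  table false false true  false = _
  table false false false true  = _
  table false false false false = _

-- With times below 4, the factor 4 in `tile-key` keeps tiles of different depth apart.
time≤3 : ∀ m₁ m₂ m₃ m₄ a b c d → time m₁ m₂ m₃ m₄ a b c d ≤ 3
time≤3 true  true  true  true  a b c d = time₄≤3 a b c d
time≤3 true  true  true  false a b c d = time₃≤3 a b c
time≤3 true  true  false true  a b c d = time₃≤3 a b d
time≤3 true  true  false false a b c d = z≤n
time≤3 true  false true  true  a b c d = time₃≤3 a c d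
time≤3 true  false true  false a b c d = z≤n
time≤3 true  false false true  a b c d = z≤n
time≤3 true  false false false a b c d = time₁≤3 a
time≤3 false true  true  true  a b c d = time₃≤3 b c d
time≤3 false true  true  false a b c d = z≤n
time≤3 false true  false true  a b c d = z≤n
time≤3 false true  false false a b c d = time₁≤3 b
time≤3 false false true  true  a b c d = z≤n
time≤3 false false true  false a b c d = time₁≤3 c
time≤3 false false false true  a b c d = time₁≤3 d
time≤3 false false false false a b c d = z≤n

OnGrid : Set → Set
OnGrid A = (x₁ x₂ x₃ x₄ : ℕ) → A

Point : Set
Point = ℕ × ℕ × ℕ × ℕ

onTile : ∀ {A} → OnGrid A → OnGrid (Tesseract A)
onTile f t₁ t₂ t₃ t₄ a b c d = f (place t₁ a) (place t₂ b) (place t₃ c) (place t₄ d)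

-- The recursion over the tiles

module Colouring (n₁ n₂ n₃ n₄ : ℕ) (L : OnGrid (List ℕ)) (l : ∀ x₁ x₂ x₃ x₄ → ListOf4 (L x₁ x₂ x₃ x₄))
  (k : OnGrid ℕ) (k∈L : ∀ x₁ x₂ x₃ x₄ → k x₁ x₂ x₃ x₄ ∈ L x₁ x₂ x₃ x₄) where

  -- A tile needs the tiles with one coordinate larger by one, so the recursion runs on fuel. When
  -- it is exhausted, the colouring `k` serves as default.
  tile-colour : ℕ → OnGrid (Tesseract ℕ)
  tile-solution : (fuel t₁ t₂ t₃ t₄ : ℕ) →
    TileSolution (layered n₁ t₁) (layered n₂ t₂) (layered n₃ t₃) (layered n₄ t₄) (onTile L t₁ t₂ t₃ t₄)
      (λ a b c d → tile-colour fuel (suc t₁) t₂ t₃ t₄ true b c d)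
      (λ a b c d → tile-colour fuel t₁ (suc t₂) t₃ t₄ a true c d)
      (λ a b c d → tile-colour fuel t₁ t₂ (suc t₃) t₄ a b true d)
      (λ a b c d → tile-colour fuel t₁ t₂ t₃ (suc t₄) a b c true)
      (onTile k t₁ t₂ t₃ t₄)

  tile-colour zero       t₁ t₂ t₃ t₄ = onTile k t₁ t₂ t₃ t₄
  tile-colour (suc fuel) t₁ t₂ t₃ t₄ = TileSolution.γ (tile-solution fuel t₁ t₂ t₃ t₄)

  tile-solution fuel t₁ t₂ t₃ t₄ = solve-tile _ _ _ _ _ _ _ _ _
    _ (λ _ _ _ _ → l _ _ _ _) (λ _ _ _ _ → k∈L _ _ _ _)

  size : ℕ
  size = n₁ + (n₂ + (n₃ + n₄))

  depth : OnGrid ℕ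
  depth t₁ t₂ t₃ t₄ = t₁ + (t₂ + (t₃ + t₄))

  time-at : OnGrid (Tesseract ℕ)
  time-at t₁ t₂ t₃ t₄ = time (layered n₁ t₁) (layered n₂ t₂) (layered n₃ t₃) (layered n₄ t₄)

  -- The vertices are coloured in the order of their keys: far tiles first.
  tile-key : OnGrid (Tesseract ℕ)
  tile-key t₁ t₂ t₃ t₄ a b c d = 4 * (suc size ∸ depth t₁ t₂ t₃ t₄) + time-at t₁ t₂ t₃ t₄ a b c d

  -- A step to the next tile raises the depth and lowers the fuel by one, so the outer colours that
  -- a tile sees are the final ones.
  tile-final : OnGrid (Tesseract ℕ)
  tile-final t₁ t₂ t₃ t₄ = tile-colour (suc size ∸ depth t₁ t₂ t₃ t₄) t₁ t₂ t₃ t₄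

  byTile : ∀ {A} → OnGrid (Tesseract A) → OnGrid A
  byTile f x₁ x₂ x₃ x₄ = f ⌊ x₁ /2⌋ ⌊ x₂ /2⌋ ⌊ x₃ /2⌋ ⌊ x₄ /2⌋ (even x₁) (even x₂) (even x₃) (even x₄)

  colouring key : OnGrid ℕ
  colouring = byTile tile-final
  key       = byTile tile-key

  record Inside (x₁ x₂ x₃ x₄ : ℕ) : Set where
    constructor inside
    field
      x₁<n₁ : x₁ < n₁
      x₂<n₂ : x₂ < n₂
      x₃<n₃ : x₃ < n₃
      x₄<n₄ : x₄ < n₄

  depth≤size : ∀ {x₁ x₂ x₃ x₄} → Inside x₁ x₂ x₃ x₄ → depth ⌊ x₁ /2⌋ ⌊ x₂ /2⌋ ⌊ x₃ /2⌋ ⌊ x₄ /2⌋ ≤ size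
  depth≤size (inside p₁ p₂ p₃ p₄) = +-mono-≤ (half p₁) (+-mono-≤ (half p₂) (+-mono-≤ (half p₃) (half p₄)))
    where
    half : ∀ {x n} → x < n → ⌊ x /2⌋ ≤ n
    half {x} p = ≤-trans (⌊n/2⌋≤n x) (<⇒≤ p)

  -- The fuel is counted from `suc size`, which leaves it positive even at depth `size`.
  tile-final-solution : ∀ t₁ t₂ t₃ t₄ → depth t₁ t₂ t₃ t₄ ≤ size →
    tile-final t₁ t₂ t₃ t₄ ≡ TileSolution.γ (tile-solution (size ∸ depth t₁ t₂ t₃ t₄) t₁ t₂ t₃ t₄)
  tile-final-solution t₁ t₂ t₃ t₄ d≤ = cong (λ fuel → tile-colour fuel t₁ t₂ t₃ t₄) (+-∸-assoc 1 d≤)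

  nearby : OnGrid (Tesseract (List Item))
  nearby t₁ t₂ t₃ t₄ a b c d =
    look 0F (layered n₁ t₁) a (tile-final (suc t₁) t₂ t₃ t₄ true b c d)
      (time-at t₁ t₂ t₃ t₄ (not a) b c d <ᵇ time-at t₁ t₂ t₃ t₄ a b c d) (tile-final t₁ t₂ t₃ t₄ (not a) b c d)
    (look 1F (layered n₂ t₂) b (tile-final t₁ (suc t₂) t₃ t₄ a true c d)
      (time-at t₁ t₂ t₃ t₄ a (not b) c d <ᵇ time-at t₁ t₂ t₃ t₄ a b c d) (tile-final t₁ t₂ t₃ t₄ a (not b) c d)
    (look 2F (layered n₃ t₃) c (tile-final t₁ t₂ (suc t₃) t₄ a b true d)
      (time-at t₁ t₂ t₃ t₄ a b (not c) d <ᵇ time-at t₁ t₂ t₃ t₄ a b c d) (tile-final t₁ t₂ t₃ t₄ a b (not c) d)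
    (look 3F (layered n₄ t₄) d (tile-final t₁ t₂ t₃ (suc t₄) a b c true)
      (time-at t₁ t₂ t₃ t₄ a b c (not d) <ᵇ time-at t₁ t₂ t₃ t₄ a b c d) (tile-final t₁ t₂ t₃ t₄ a b c (not d)) [])))

  nearby-once : ∀ {x₁ x₂ x₃ x₄} → Inside x₁ x₂ x₃ x₄ →
    AtMostOnce (colouring x₁ x₂ x₃ x₄) (byTile nearby x₁ x₂ x₃ x₄)
  nearby-once {x₁} {x₂} {x₃} {x₄} x∈@(inside p₁ p₂ p₃ p₄)
    with TileSolution.acyclic (tile-solution (size ∸ depth ⌊ x₁ /2⌋ ⌊ x₂ /2⌋ ⌊ x₃ /2⌋ ⌊ x₄ /2⌋) _ _ _ _)
           (real x₁ p₁) (real x₂ p₂) (real x₃ p₃) (real x₄ p₄)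
  ... | once
    -- The first rewrite unfolds the colours of the tile itself. The others bring the successor in
    -- the depth of a next tile to the front; in the first direction it is there already.
    rewrite tile-final-solution ⌊ x₁ /2⌋ ⌊ x₂ /2⌋ ⌊ x₃ /2⌋ ⌊ x₄ /2⌋ (depth≤size x∈)
          | +-suc ⌊ x₁ /2⌋ (⌊ x₂ /2⌋ + (⌊ x₃ /2⌋ + ⌊ x₄ /2⌋))
          | +-suc ⌊ x₂ /2⌋ (⌊ x₃ /2⌋ + ⌊ x₄ /2⌋) | +-suc ⌊ x₁ /2⌋ (⌊ x₂ /2⌋ + (⌊ x₃ /2⌋ + ⌊ x₄ /2⌋))
          | +-suc ⌊ x₃ /2⌋ ⌊ x₄ /2⌋ | +-suc ⌊ x₂ /2⌋ (⌊ x₃ /2⌋ + ⌊ x₄ /2⌋) | +-suc ⌊ x₁ /2⌋ (⌊ x₂ /2⌋ + (⌊ x₃ /2⌋ + ⌊ x₄ /2⌋))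
    = once



  -- Within a tile, keys compare as times do. Equal times and equal colours would make the vertices
  -- equal by `injective`, so the inequality of the times is strict.
  earlier : ∀ t₁ t₂ t₃ t₄ {a b c d a′ b′ c′ d′} → depth t₁ t₂ t₃ t₄ ≤ size →
    Real (layered n₁ t₁) a → Real (layered n₂ t₂) b → Real (layered n₃ t₃) c → Real (layered n₄ t₄) d →
    Real (layered n₁ t₁) a′ → Real (layered n₂ t₂) b′ → Real (layered n₃ t₃) c′ → Real (layered n₄ t₄) d′ →
    tile-key t₁ t₂ t₃ t₄ a′ b′ c′ d′ ≤ tile-key t₁ t₂ t₃ t₄ a b c d →
    tile-final t₁ t₂ t₃ t₄ a′ b′ c′ d′ ≡ tile-final t₁ t₂ t₃ t₄ a b c d → (a′ , b′ , c′ , d′) ≢ (a , b , c , d) →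
    (time-at t₁ t₂ t₃ t₄ a′ b′ c′ d′ <ᵇ time-at t₁ t₂ t₃ t₄ a b c d) ≡ true
  earlier t₁ t₂ t₃ t₄ {a} {b} {c} {d} {a′} {b′} {c′} {d′} d≤ ra rb rc rd ra′ rb′ rc′ rd′ key≤ same differ =
    <⇒<ᵇ≡true (≤∧≢⇒< (+-cancelˡ-≤ (4 * (suc size ∸ depth t₁ t₂ t₃ t₄)) _ _ key≤)
      λ same-time → differ (TileSolution.injective (tile-solution (size ∸ depth t₁ t₂ t₃ t₄) t₁ t₂ t₃ t₄)
        ra′ rb′ rc′ rd′ ra rb rc rd same-time
        (subst (λ γ → γ a′ b′ c′ d′ ≡ γ a b c d) (tile-final-solution t₁ t₂ t₃ t₄ d≤) same)))

  -- One step in depth changes the key by 4, which a time of at most 3 cannot make up for.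
  nearer-is-later : ∀ {d d′ τ τ′} → d ≡ suc d′ → d ≤ size → τ ≤ 3 →
    ¬ (4 * (suc size ∸ d′) + τ′ ≤ 4 * (suc size ∸ d) + τ)
  nearer-is-later {d′ = d′} {τ} {τ′} refl d≤ τ≤3 key≤ = n≮n (4 * (size ∸ d′) + 3) (begin-strict
    4 * (size ∸ d′) + 3           <⟨ +-monoʳ-< (4 * (size ∸ d′)) (n<1+n 3) ⟩
    4 * (size ∸ d′) + 4           ≡⟨ +-comm (4 * (size ∸ d′)) 4 ⟩
    4 + 4 * (size ∸ d′)           ≡⟨ *-suc 4 (size ∸ d′) ⟨
    4 * suc (size ∸ d′)           ≡⟨ cong (4 *_) (+-∸-assoc 1 (≤-trans (n≤1+n d′) d≤)) ⟨
    4 * (suc size ∸ d′)           ≤⟨ m≤m+n _ τ′ ⟩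
    4 * (suc size ∸ d′) + τ′      ≤⟨ key≤ ⟩
    4 * (size ∸ d′) + τ           ≤⟨ +-monoʳ-≤ (4 * (size ∸ d′)) τ≤3 ⟩
    4 * (size ∸ d′) + 3           ∎)
    where open ≤-Reasoning

  -- Decodes the tag of an item, so that equal tags mean equal neighbours.
  neighbour : Fin 4 × Bool → Point → Point
  neighbour (0F , true)  (x₁ , x₂ , x₃ , x₄) = suc x₁ , x₂ , x₃ , x₄
  neighbour (0F , false) (x₁ , x₂ , x₃ , x₄) = buddy x₁ , x₂ , x₃ , x₄
  neighbour (1F , true)  (x₁ , x₂ , x₃ , x₄) = x₁ , suc x₂ , x₃ , x₄
  neighbour (1F , false) (x₁ , x₂ , x₃ , x₄) = x₁ , buddy x₂ , x₃ , x₄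
  neighbour (2F , true)  (x₁ , x₂ , x₃ , x₄) = x₁ , x₂ , suc x₃ , x₄
  neighbour (2F , false) (x₁ , x₂ , x₃ , x₄) = x₁ , x₂ , buddy x₃ , x₄
  neighbour (3F , true)  (x₁ , x₂ , x₃ , x₄) = x₁ , x₂ , x₃ , suc x₄
  neighbour (3F , false) (x₁ , x₂ , x₃ , x₄) = x₁ , x₂ , x₃ , buddy x₄

  Found : (x₁ x₂ x₃ x₄ : ℕ) → Point → Set
  Found x₁ x₂ x₃ x₄ y = ∃ λ tag →
    (tag , colouring x₁ x₂ x₃ x₄) ∈ byTile nearby x₁ x₂ x₃ x₄ × y ≡ neighbour tag (x₁ , x₂ , x₃ , x₄)

  -- An outward step is always listed, a step within the tile is listed by `earlier`, and a step
  -- back is excluded by `nearer-is-later`. The other directions follow the same pattern, skipping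
  -- the entries of the directions before them.
  find₁ : ∀ {x₁ x₂ x₃ x₄ y} → Inside x₁ x₂ x₃ x₄ → Move n₁ x₁ y → key y x₂ x₃ x₄ ≤ key x₁ x₂ x₃ x₄ →
    colouring y x₂ x₃ x₄ ≡ colouring x₁ x₂ x₃ x₄ → Found x₁ x₂ x₃ x₄ (y , x₂ , x₃ , x₄)
  find₁ {x₁} {x₂} {x₃} {x₄} _ (outward odd refl h e) _ same rewrite h | e =
    (0F , true) , subst (λ α → (_ , α) ∈ byTile nearby x₁ x₂ x₃ x₄) same (look-outward (layered n₁ ⌊ x₁ /2⌋) (even x₁) odd) , refl
  find₁ {x₁} {x₂} {x₃} {x₄} x∈@(inside p₁ p₂ p₃ p₄) (across m refl h e) key≤ same rewrite h | e =
    (0F , false) , subst (λ α → (_ , α) ∈ byTile nearby x₁ x₂ x₃ x₄) same (look-across (layered n₁ ⌊ x₁ /2⌋) (even x₁) m (earlier ⌊ x₁ /2⌋ ⌊ x₂ /2⌋ ⌊ x₃ /2⌋ ⌊ x₄ /2⌋ (depth≤size x∈)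
      (real x₁ p₁) (real x₂ p₂) (real x₃ p₃) (real x₄ p₄)
      (both m (not (even x₁))) (real x₂ p₂) (real x₃ p₃) (real x₄ p₄)
      -- The bit in the direction of the move is negated, so the two vertices differ.
      key≤ same (not-¬ refl ∘ sym ∘ cong proj₁))) , refl
  find₁ {x₁} {x₂} {x₃} {x₄} x∈ (back h) key≤ _ = contradiction key≤ (nearer-is-later
    (trans (cong (λ h → h + (⌊ x₂ /2⌋ + (⌊ x₃ /2⌋ + ⌊ x₄ /2⌋))) h) refl)
    (depth≤size x∈) (time≤3 (layered n₁ ⌊ x₁ /2⌋) (layered n₂ ⌊ x₂ /2⌋) (layered n₃ ⌊ x₃ /2⌋) (layered n₄ ⌊ x₄ /2⌋) (even x₁) (even x₂) (even x₃) (even x₄)))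

  find₂ : ∀ {x₁ x₂ x₃ x₄ y} → Inside x₁ x₂ x₃ x₄ → Move n₂ x₂ y → key x₁ y x₃ x₄ ≤ key x₁ x₂ x₃ x₄ →
    colouring x₁ y x₃ x₄ ≡ colouring x₁ x₂ x₃ x₄ → Found x₁ x₂ x₃ x₄ (x₁ , y , x₃ , x₄)
  find₂ {x₁} {x₂} {x₃} {x₄} _ (outward odd refl h e) _ same rewrite h | e =
    (1F , true) , subst (λ α → (_ , α) ∈ byTile nearby x₁ x₂ x₃ x₄) same (look-further (layered n₁ ⌊ x₁ /2⌋) (even x₁) (look-outward (layered n₂ ⌊ x₂ /2⌋) (even x₂) odd)) , refl
  find₂ {x₁} {x₂} {x₃} {x₄} x∈@(inside p₁ p₂ p₃ p₄) (across m refl h e) key≤ same rewrite h | e =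
    (1F , false) , subst (λ α → (_ , α) ∈ byTile nearby x₁ x₂ x₃ x₄) same (look-further (layered n₁ ⌊ x₁ /2⌋) (even x₁) (look-across (layered n₂ ⌊ x₂ /2⌋) (even x₂) m (earlier ⌊ x₁ /2⌋ ⌊ x₂ /2⌋ ⌊ x₃ /2⌋ ⌊ x₄ /2⌋ (depth≤size x∈)
      (real x₁ p₁) (real x₂ p₂) (real x₃ p₃) (real x₄ p₄)
      (real x₁ p₁) (both m (not (even x₂))) (real x₃ p₃) (real x₄ p₄)
      key≤ same (not-¬ refl ∘ sym ∘ cong (proj₁ ∘ proj₂))))) , refl
  find₂ {x₁} {x₂} {x₃} {x₄} x∈ (back h) key≤ _ = contradiction key≤ (nearer-is-later
    (trans (cong (λ h → ⌊ x₁ /2⌋ + (h + (⌊ x₃ /2⌋ + ⌊ x₄ /2⌋))) h) (+-suc ⌊ x₁ /2⌋ _))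
    (depth≤size x∈) (time≤3 (layered n₁ ⌊ x₁ /2⌋) (layered n₂ ⌊ x₂ /2⌋) (layered n₃ ⌊ x₃ /2⌋) (layered n₄ ⌊ x₄ /2⌋) (even x₁) (even x₂) (even x₃) (even x₄)))

  find₃ : ∀ {x₁ x₂ x₃ x₄ y} → Inside x₁ x₂ x₃ x₄ → Move n₃ x₃ y → key x₁ x₂ y x₄ ≤ key x₁ x₂ x₃ x₄ →
    colouring x₁ x₂ y x₄ ≡ colouring x₁ x₂ x₃ x₄ → Found x₁ x₂ x₃ x₄ (x₁ , x₂ , y , x₄)
  find₃ {x₁} {x₂} {x₃} {x₄} _ (outward odd refl h e) _ same rewrite h | e =
    (2F , true) , subst (λ α → (_ , α) ∈ byTile nearby x₁ x₂ x₃ x₄) same (look-further (layered n₁ ⌊ x₁ /2⌋) (even x₁) (look-further (layered n₂ ⌊ x₂ /2⌋) (even x₂) (look-outward (layered n₃ ⌊ x₃ /2⌋) (even x₃) odd))) , refl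
  find₃ {x₁} {x₂} {x₃} {x₄} x∈@(inside p₁ p₂ p₃ p₄) (across m refl h e) key≤ same rewrite h | e =
    (2F , false) , subst (λ α → (_ , α) ∈ byTile nearby x₁ x₂ x₃ x₄) same (look-further (layered n₁ ⌊ x₁ /2⌋) (even x₁) (look-further (layered n₂ ⌊ x₂ /2⌋) (even x₂) (look-across (layered n₃ ⌊ x₃ /2⌋) (even x₃) m (earlier ⌊ x₁ /2⌋ ⌊ x₂ /2⌋ ⌊ x₃ /2⌋ ⌊ x₄ /2⌋ (depth≤size x∈)
      (real x₁ p₁) (real x₂ p₂) (real x₃ p₃) (real x₄ p₄)
      (real x₁ p₁) (real x₂ p₂) (both m (not (even x₃))) (real x₄ p₄)
      key≤ same (not-¬ refl ∘ sym ∘ cong (proj₁ ∘ proj₂ ∘ proj₂)))))) , refl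
  find₃ {x₁} {x₂} {x₃} {x₄} x∈ (back h) key≤ _ = contradiction key≤ (nearer-is-later
    (trans (cong (λ h → ⌊ x₁ /2⌋ + (⌊ x₂ /2⌋ + (h + ⌊ x₄ /2⌋))) h) (trans (cong (⌊ x₁ /2⌋ +_) (+-suc ⌊ x₂ /2⌋ _)) (+-suc ⌊ x₁ /2⌋ _)))
    (depth≤size x∈) (time≤3 (layered n₁ ⌊ x₁ /2⌋) (layered n₂ ⌊ x₂ /2⌋) (layered n₃ ⌊ x₃ /2⌋) (layered n₄ ⌊ x₄ /2⌋) (even x₁) (even x₂) (even x₃) (even x₄)))

  find₄ : ∀ {x₁ x₂ x₃ x₄ y} → Inside x₁ x₂ x₃ x₄ → Move n₄ x₄ y → key x₁ x₂ x₃ y ≤ key x₁ x₂ x₃ x₄ →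
    colouring x₁ x₂ x₃ y ≡ colouring x₁ x₂ x₃ x₄ → Found x₁ x₂ x₃ x₄ (x₁ , x₂ , x₃ , y)
  find₄ {x₁} {x₂} {x₃} {x₄} _ (outward odd refl h e) _ same rewrite h | e =
    (3F , true) , subst (λ α → (_ , α) ∈ byTile nearby x₁ x₂ x₃ x₄) same (look-further (layered n₁ ⌊ x₁ /2⌋) (even x₁) (look-further (layered n₂ ⌊ x₂ /2⌋) (even x₂) (look-further (layered n₃ ⌊ x₃ /2⌋) (even x₃) (look-outward (layered n₄ ⌊ x₄ /2⌋) (even x₄) odd)))) , refl
  find₄ {x₁} {x₂} {x₃} {x₄} x∈@(inside p₁ p₂ p₃ p₄) (across m refl h e) key≤ same rewrite h | e =
    (3F , false) , subst (λ α → (_ , α) ∈ byTile nearby x₁ x₂ x₃ x₄) same (look-further (layered n₁ ⌊ x₁ /2⌋) (even x₁) (look-further (layered n₂ ⌊ x₂ /2⌋) (even x₂) (look-further (layered n₃ ⌊ x₃ /2⌋) (even x₃) (look-across (layered n₄ ⌊ x₄ /2⌋) (even x₄) m (earlier ⌊ x₁ /2⌋ ⌊ x₂ /2⌋ ⌊ x₃ /2⌋ ⌊ x₄ /2⌋ (depth≤size x∈)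
      (real x₁ p₁) (real x₂ p₂) (real x₃ p₃) (real x₄ p₄)
      (real x₁ p₁) (real x₂ p₂) (real x₃ p₃) (both m (not (even x₄)))
      key≤ same (not-¬ refl ∘ sym ∘ cong (proj₂ ∘ proj₂ ∘ proj₂))))))) , refl
  find₄ {x₁} {x₂} {x₃} {x₄} x∈ (back h) key≤ _ = contradiction key≤ (nearer-is-later
    (trans (cong (λ h → ⌊ x₁ /2⌋ + (⌊ x₂ /2⌋ + (⌊ x₃ /2⌋ + h))) h) (trans (cong (⌊ x₁ /2⌋ +_) (trans (cong (⌊ x₂ /2⌋ +_) (+-suc ⌊ x₃ /2⌋ _)) (+-suc ⌊ x₂ /2⌋ _))) (+-suc ⌊ x₁ /2⌋ _)))
    (depth≤size x∈) (time≤3 (layered n₁ ⌊ x₁ /2⌋) (layered n₂ ⌊ x₂ /2⌋) (layered n₃ ⌊ x₃ /2⌋) (layered n₄ ⌊ x₄ /2⌋) (even x₁) (even x₂) (even x₃) (even x₄)))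

-- Acyclicity

argmax : ∀ {n} (f : Fin (suc n) → ℕ) → ∃ λ i → ∀ j → f j ≤ f i
argmax {zero} f = zero , λ { zero → ≤-refl }
argmax {suc n} f with argmax (λ i → f (suc i))
... | i , max with ≤-total (f zero) (f (suc i))
...   | inj₁ p = suc i , λ { zero → p ; (suc j) → max j }
...   | inj₂ p = zero , λ { zero → ≤-refl ; (suc j) → ≤-trans (max j) p }

module _ {G : Graph} (sym-Adj : ∀ {v w} → Adj G v w → Adj G w v) (C : Cycle G) where

  open Cycle C

  private
    predecessor : ∀ i → ∃ λ j → Adj G (vtx i) (vtx j) × (toℕ i ≡ suc (toℕ j) ⊎ (toℕ i ≡ 0 × toℕ j ≡ suc (suc len)))
    predecessor zero    = fromℕ _ , sym-Adj close , inj₂ (refl , Fin.toℕ-fromℕ _)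
    predecessor (suc k) = inject₁ k , sym-Adj (step k) , inj₁ (cong suc (sym (Fin.toℕ-inject₁ k)))

    successor : ∀ i → ∃ λ j → Adj G (vtx i) (vtx j) × (toℕ j ≡ suc (toℕ i) ⊎ (toℕ j ≡ 0 × toℕ i ≡ suc (suc len)))
    successor i with view i
    ... | ‵fromℕ     = zero , close , inj₂ (refl , Fin.toℕ-fromℕ _)
    ... | ‵inject₁ k = suc k , step k , inj₁ (cong suc (sym (Fin.toℕ-inject₁ k)))

  -- These are the predecessor and the successor on the cycle, which differ because a cycle has at
  -- least three vertices.
  two-neighbours : ∀ i → ∃₂ λ j k → j ≢ k × Adj G (vtx i) (vtx j) × Adj G (vtx i) (vtx k)
  two-neighbours i with predecessor i | successor i
  ... | j , i~j , p | k , i~k , s = j , k , (λ { refl → differ (toℕ i) (toℕ j) p s }) , i~j , i~k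
    where
    differ : ∀ a b → a ≡ suc b ⊎ (a ≡ 0 × b ≡ suc (suc len)) → ¬ (b ≡ suc a ⊎ (b ≡ 0 × a ≡ suc (suc len)))
    differ a b (inj₁ refl) (inj₁ e) = contradiction e (<⇒≢ (≤-trans (n<1+n b) (n≤1+n (suc b))))
    differ _ _ (inj₁ refl) (inj₂ (refl , ()))
    differ _ _ (inj₂ (refl , refl)) (inj₁ ())
    differ _ _ (inj₂ (refl , refl)) (inj₂ (() , _))

-- The vertex of largest key on a monochromatic cycle would have two such neighbours.
sparse⇒acyclic : ∀ (G : Graph) → (∀ {v w} → Adj G v w → Adj G w v) → (c key : V G → ℕ) →
  (∀ {v w w′} → Adj G v w → Adj G v w′ → key w ≤ key v → key w′ ≤ key v → c w ≡ c v → c w′ ≡ c v → w ≡ w′) →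
  ClassesAcyclic G c
sparse⇒acyclic G sym-Adj c key sparse a C mono with argmax (λ i → key (Cycle.vtx C i))
... | i , max with two-neighbours {G} sym-Adj C i
...   | j , k , j≢k , i~j , i~k = j≢k (Cycle.inj C (sparse i~j i~k (max j) (max k)
          (trans (mono j) (sym (mono i))) (trans (mono k) (sym (mono i)))))

-- Counting

total : ∀ {A : Set} → (A → ℕ) → List A → ℕ
total f xs = sum (map f xs)

module _ {A : Set} where

  total-cong : ∀ {f g : A → ℕ} {xs} → All (λ x → f x ≡ g x) xs → total f xs ≡ total g xs
  total-cong []       = refl
  total-cong (e ∷ es) = cong₂ _+_ e (total-cong es)

  total-+ : ∀ (f g : A → ℕ) xs → total (λ x → f x + g x) xs ≡ total f xs + total g xs
  total-+ f g []       = refl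
  total-+ f g (x ∷ xs) = trans (cong (f x + g x +_) (total-+ f g xs)) (interchange (f x) (g x) _ _)

  total-++ : ∀ (f : A → ℕ) xs ys → total f (xs ++ ys) ≡ total f xs + total f ys
  total-++ f xs ys = trans (cong sum (map-++ f xs ys)) (sum-++ (map f xs) (map f ys))

  total-one : ∀ (xs : List A) → total (λ _ → 1) xs ≡ length xs
  total-one []       = refl
  total-one (x ∷ xs) = cong suc (total-one xs)

  length-filter-total : ∀ (c : A → ℕ) e xs → length (filter (λ x → c x ≟ e) xs) ≡ total (λ x → [ c x ≈ e ]) xs
  length-filter-total c e [] = refl
  length-filter-total c e (x ∷ xs) with does (c x ≟ e)
  ... | true  = cong suc (length-filter-total c e xs)
  ... | false = length-filter-total c e xs

  total-filter : ∀ (p : A → Bool) (f : A → ℕ) xs →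
    total f (filter (T? ∘ p) xs) ≡ total (λ x → if p x then f x else 0) xs
  total-filter p f [] = refl
  total-filter p f (x ∷ xs) with p x
  ... | true  = cong (f x +_) (total-filter p f xs)
  ... | false = total-filter p f xs

total-cartesianProduct : ∀ {A B : Set} (f : A × B → ℕ) xs ys →
  total f (cartesianProduct xs ys) ≡ total (λ x → total (λ y → f (x , y)) ys) xs
total-cartesianProduct f [] ys = refl
total-cartesianProduct f (x ∷ xs) ys = trans (total-++ f (map (x ,_) ys) _)
  (cong₂ _+_ (cong sum (sym (map-∘ ys))) (total-cartesianProduct f xs ys))

range : ℕ → (ℕ → ℕ) → ℕ
range zero    f = 0
range (suc n) f = f 0 + range n (f ∘ suc)

total-allFin : ∀ n (f : ℕ → ℕ) → total (f ∘ toℕ) (allFin n) ≡ range n f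
total-allFin n f = trans (cong sum (map-tabulate {n = n} (λ i → i) (f ∘ toℕ))) (go n f)
  where
  go : ∀ n f → sum (tabulate {n = n} (f ∘ toℕ)) ≡ range n f
  go zero    f = refl
  go (suc n) f = cong (f 0 +_) (go n (f ∘ suc))

range-cong : ∀ n {f g : ℕ → ℕ} → (∀ x → f x ≡ g x) → range n f ≡ range n g
range-cong zero    e = refl
range-cong (suc n) e = cong₂ _+_ (e 0) (range-cong n (e ∘ suc))

range-4* : ∀ n {f g : ℕ → ℕ} → (∀ x → x < n → 4 * f x ≤ g x) → 4 * range n f ≤ range n g
range-4* zero p = z≤n
range-4* (suc n) {f} p = ≤-trans (≤-reflexive (*-distribˡ-+ 4 (f 0) _))
  (+-mono-≤ (p 0 (s≤s z≤n)) (range-4* n λ x x<n → p (suc x) (s≤s x<n)))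

range-+ : ∀ n (f g : ℕ → ℕ) → range n (λ x → f x + g x) ≡ range n f + range n g
range-+ zero    f g = refl
range-+ (suc n) f g = trans (cong (f 0 + g 0 +_) (range-+ n (f ∘ suc) (g ∘ suc))) (interchange (f 0) (g 0) _ _)

layers-cong : ∀ m {f g : Bool → ℕ} → (∀ q → f q ≡ g q) → layers m f ≡ layers m g
layers-cong true  e = cong₂ _+_ (e true) (e false)
layers-cong false e = e true

layers-range : ∀ m n (f : Bool → ℕ → ℕ) → layers m (λ q → range n (f q)) ≡ range n (λ t → layers m (λ q → f q t))
layers-range true  n f = sym (range-+ n (f true) (f false))
layers-range false n f = refl

layers-zero : ∀ m {z} → z ≡ 0 → layers m (λ _ → z) ≡ 0
layers-zero true  refl = refl
layers-zero false refl = refl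

-- The recursion splits off one block of two at a time; an odd length leaves a last block with a
-- single layer.
range-layers : ∀ n (f : ℕ → ℕ) → range n f ≡ range ⌈ n /2⌉ (λ t → layers (layered n t) (λ q → f (place t q)))
range-layers 0 f = refl
range-layers 1 f = refl
range-layers (suc (suc n)) f = trans (cong (λ z → f 0 + (f 1 + z)) (range-layers n (λ x → f (suc (suc x)))))
  (sym (+-assoc (f 0) (f 1) _))

range₄ : (n₁ n₂ n₃ n₄ : ℕ) → OnGrid ℕ → ℕ
range₄ n₁ n₂ n₃ n₄ f = range n₁ λ x₁ → range n₂ λ x₂ → range n₃ λ x₃ → range n₄ λ x₄ → f x₁ x₂ x₃ x₄

range₄-cong : ∀ n₁ n₂ n₃ n₄ {f g : OnGrid ℕ} → (∀ x₁ x₂ x₃ x₄ → f x₁ x₂ x₃ x₄ ≡ g x₁ x₂ x₃ x₄) →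
  range₄ n₁ n₂ n₃ n₄ f ≡ range₄ n₁ n₂ n₃ n₄ g
range₄-cong n₁ n₂ n₃ n₄ e = range-cong n₁ λ x₁ → range-cong n₂ λ x₂ → range-cong n₃ λ x₃ → range-cong n₄ λ x₄ → e x₁ x₂ x₃ x₄

module Tiles (n₁ n₂ n₃ n₄ : ℕ) where

  tile-total : (t₁ t₂ t₃ t₄ : ℕ) → Tesseract ℕ → ℕ
  tile-total t₁ t₂ t₃ t₄ f = layers (layered n₁ t₁) λ a → layers (layered n₂ t₂) λ b →
    layers (layered n₃ t₃) λ c → layers (layered n₄ t₄) λ d → f a b c d

  -- From the last direction to the first, each range is cut into blocks, and the sum over layers is
  -- moved inwards past the ranges of the later directions.
  range₄-tiles : ∀ f → range₄ n₁ n₂ n₃ n₄ f ≡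
    range₄ ⌈ n₁ /2⌉ ⌈ n₂ /2⌉ ⌈ n₃ /2⌉ ⌈ n₄ /2⌉ (λ t₁ t₂ t₃ t₄ → tile-total t₁ t₂ t₃ t₄ (onTile f t₁ t₂ t₃ t₄))
  range₄-tiles f = begin
    range₄ n₁ n₂ n₃ n₄ f
      ≡⟨ (range-cong n₁ λ x₁ → range-cong n₂ λ x₂ → range-cong n₃ λ x₃ → range-layers n₄ _) ⟩
    _ ≡⟨ (range-cong n₁ λ x₁ → range-cong n₂ λ x₂ → range-layers n₃ _) ⟩
    _ ≡⟨ (range-cong n₁ λ x₁ → range-cong n₂ λ x₂ → range-cong h₃ λ t₃ → layers-range (layered n₃ t₃) h₄ _) ⟩
    _ ≡⟨ (range-cong n₁ λ x₁ → range-layers n₂ _) ⟩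
    _ ≡⟨ (range-cong n₁ λ x₁ → range-cong h₂ λ t₂ → layers-range (layered n₂ t₂) h₃ _) ⟩
    _ ≡⟨ (range-cong n₁ λ x₁ → range-cong h₂ λ t₂ → range-cong h₃ λ t₃ → layers-range (layered n₂ t₂) h₄ _) ⟩
    _ ≡⟨ range-layers n₁ _ ⟩
    _ ≡⟨ (range-cong h₁ λ t₁ → layers-range (layered n₁ t₁) h₂ _) ⟩
    _ ≡⟨ (range-cong h₁ λ t₁ → range-cong h₂ λ t₂ → layers-range (layered n₁ t₁) h₃ _) ⟩
    _ ≡⟨ (range-cong h₁ λ t₁ → range-cong h₂ λ t₂ → range-cong h₃ λ t₃ → layers-range (layered n₁ t₁) h₄ _) ⟩
    range₄ h₁ h₂ h₃ h₄ (λ t₁ t₂ t₃ t₄ → tile-total t₁ t₂ t₃ t₄ (onTile f t₁ t₂ t₃ t₄)) ∎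
    where
    open ≡-Reasoning
    h₁ = ⌈ n₁ /2⌉
    h₂ = ⌈ n₂ /2⌉
    h₃ = ⌈ n₃ /2⌉
    h₄ = ⌈ n₄ /2⌉

-- Colouring in groups of four

module Chunks {A : Set} (_≟ᴬ_ : DecidableEquality A) (L : A → List ℕ) (l : ∀ v → ListOf4 (L v)) where

  open DecMembership _≟ᴬ_ using (_∈?_)

  override : (A → ℕ) → List A → (A → ℕ) → A → ℕ
  override k vs k′ v = if does (v ∈? vs) then k v else k′ v

  override-in : ∀ k vs k′ {v} → v ∈ vs → override k vs k′ v ≡ k v
  override-in k vs k′ {v} v∈ = cong (λ b → if b then k v else k′ v) (dec-true (v ∈? vs) v∈)

  override-out : ∀ k vs k′ {v} → ¬ v ∈ vs → override k vs k′ v ≡ k′ v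
  override-out k vs k′ {v} v∉ = cong (λ b → if b then k v else k′ v) (dec-false (v ∈? vs) v∉)

  override-allowed : ∀ {k} vs {k′} → (∀ v → k v ∈ L v) → (∀ v → k′ v ∈ L v) → ∀ v → override k vs k′ v ∈ L v
  override-allowed vs p p′ v with does (v ∈? vs)
  ... | true  = p v
  ... | false = p′ v

  class : (A → ℕ) → ℕ → List A → ℕ
  class k e = total (λ v → [ k v ≈ e ])

  class-none : ∀ {k e} vs → All (λ v → k v ≢ e) vs → class k e vs ≡ 0
  class-none []       []       = refl
  class-none (v ∷ vs) (n ∷ ns) = cong₂ _+_ (≈-no n) (class-none vs ns)

  class-override-in : ∀ k us k′ e vs → (∀ {v} → v ∈ vs → v ∈ us) → class (override k us k′) e vs ≡ class k e vs
  class-override-in k us k′ e vs sub =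
    total-cong (All.tabulate λ v∈ → cong (λ z → [ z ≈ e ]) (override-in k us k′ (sub v∈)))

  class-override-out : ∀ k us k′ e vs → (∀ {v} → v ∈ vs → ¬ v ∈ us) → class (override k us k′) e vs ≡ class k′ e vs
  class-override-out k us k′ e vs out =
    total-cong (All.tabulate λ v∈ → cong (λ z → [ z ≈ e ]) (override-out k us k′ (out v∈)))

  -- A list of four colours suffices to avoid the colours of at most three other vertices; adjacency
  -- is ignored. Colours are assigned outside `vs` as well, so that the result is allowed
  -- everywhere.
  rainbow : ∀ vs → Unique vs → length vs ≤ 4 → ∃ λ k → (∀ v → k v ∈ L v) × (∀ e → class k e vs ≤ 1)
  rainbow [] _ _ = (λ v → colour (choose₄ (l v) [] [])) , (λ v → allowed (choose₄ (l v) [] [])) , λ _ → z≤n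
  rainbow (v ∷ vs) (v∉ ∷ u) (s≤s len) with rainbow vs u (≤-trans len (n≤1+n 3))
  ... | k , k∈ , rare = override k′ (v ∷ []) k , override-allowed (v ∷ []) (λ w → allowed (pick w)) k∈ , rare′
    where
    bound : ∀ w → 2 * length (map k vs) < 2 * length (L w)
    bound w = *-monoʳ-< 2 (subst₂ _<_ (sym (length-map k vs)) (sym (proj₂ (l w))) (s≤s len))
    pick : ∀ w → Choice (L w) [] (map k vs)
    pick w = choose (L w) [] (map k vs) (proj₁ (l w)) (bound w)
    k′ = λ w → colour (pick w)
    class-vs : ∀ e → class (override k′ (v ∷ []) k) e vs ≡ class k e vs
    class-vs e = class-override-out k′ (v ∷ []) k e vs λ { w∈ (here refl) → All.lookup v∉ w∈ refl }
    rare′ : ∀ e → class (override k′ (v ∷ []) k) e (v ∷ vs) ≤ 1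
    rare′ e = begin
      class (override k′ (v ∷ []) k) e (v ∷ vs)
        ≡⟨ cong₂ (λ z r → [ z ≈ e ] + r) (override-in k′ (v ∷ []) k (here refl)) (class-vs e) ⟩
      [ k′ v ≈ e ] + class k e vs ≤⟨ at-most-1 ⟩
      1 ∎
      where
      open ≤-Reasoning
      at-most-1 : [ k′ v ≈ e ] + class k e vs ≤ 1
      at-most-1 with k′ v ≟ e
      ... | yes k′v≡e = ≤-reflexive (cong₂ _+_ (≈-yes k′v≡e)
        (class-none vs (All.map (λ n kw≡e → n (trans k′v≡e (sym kw≡e))) (All.map⁻ (fresh (pick v))))))
      ... | no k′v≢e = ≤-trans (≤-reflexive (cong (_+ class k e vs) (≈-no k′v≢e))) (rare e)

  -- A colour used once counts 4, which the length, at least 1, covers together with the 3.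
  few-chunked : ∀ vs → Unique vs → 1 ≤ length vs → length vs ≤ 4 →
    ∃ λ k → (∀ v → k v ∈ L v) × (∀ e → 4 * class k e vs ≤ length vs + 3)
  few-chunked vs u 1≤ ≤4 with rainbow vs u ≤4
  ... | k , k∈ , rare = k , k∈ , λ e → ≤-trans (*-monoʳ-≤ 4 (rare e)) (+-monoˡ-≤ 3 1≤)

  -- A full group of four meets the bound without the 3, so the rounding loss occurs only once, in
  -- an incomplete last group.
  chunked : ∀ vs → Unique vs → ∃ λ k → (∀ v → k v ∈ L v) × (∀ e → 4 * class k e vs ≤ length vs + 3)
  chunked vs@(v₁ ∷ v₂ ∷ v₃ ∷ v₄ ∷ rest) ((a ∷ b ∷ c ∷ p₁) ∷ (d ∷ e ∷ p₂) ∷ (f ∷ p₃) ∷ p₄ ∷ u)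
    with rainbow (v₁ ∷ v₂ ∷ v₃ ∷ v₄ ∷ []) ((a ∷ b ∷ c ∷ []) ∷ (d ∷ e ∷ []) ∷ (f ∷ []) ∷ [] ∷ []) ≤-refl | chunked rest u
  ... | k , k∈ , rare | k′ , k′∈ , rare′ = override k group k′ , override-allowed group k∈ k′∈ , bound
    where
    group = v₁ ∷ v₂ ∷ v₃ ∷ v₄ ∷ []
    apart : ∀ {v} → v ∈ rest → ¬ v ∈ group
    apart v∈ (here refl)                         = All.lookup p₁ v∈ refl
    apart v∈ (there (here refl))                 = All.lookup p₂ v∈ refl
    apart v∈ (there (there (here refl)))         = All.lookup p₃ v∈ refl
    apart v∈ (there (there (there (here refl)))) = All.lookup p₄ v∈ refl
    bound : ∀ e → 4 * class (override k group k′) e vs ≤ length vs + 3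
    bound e = begin
      4 * class (override k group k′) e (group ++ rest)
        ≡⟨ cong (4 *_) (total-++ (λ v → [ override k group k′ v ≈ e ]) group rest) ⟩
      4 * (class (override k group k′) e group + class (override k group k′) e rest)
        ≡⟨ cong (4 *_) (cong₂ _+_ (class-override-in k group k′ e group (λ v∈ → v∈))
                                  (class-override-out k group k′ e rest apart)) ⟩
      4 * (class k e group + class k′ e rest)     ≡⟨ *-distribˡ-+ 4 (class k e group) _ ⟩
      4 * class k e group + 4 * class k′ e rest   ≤⟨ +-mono-≤ (*-monoʳ-≤ 4 (rare e)) (rare′ e) ⟩
      4 + (length rest + 3)                       ∎
      where open ≤-Reasoning
  chunked [] u with rainbow [] u z≤n
  ... | k , k∈ , _ = k , k∈ , λ _ → z≤n
  chunked vs@(_ ∷ [])         u = few-chunked vs u (s≤s z≤n) (s≤s z≤n)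
  chunked vs@(_ ∷ _ ∷ [])     u = few-chunked vs u (s≤s z≤n) (s≤s (s≤s z≤n))
  chunked vs@(_ ∷ _ ∷ _ ∷ []) u = few-chunked vs u (s≤s z≤n) (s≤s (s≤s (s≤s z≤n)))

-- The grid graph

<⌈/2⌉⇒≤ : ∀ {n t} → t < ⌈ n /2⌉ → t ≤ n
<⌈/2⌉⇒≤ {n} p = ≤-trans (<⇒≤ p) (⌈n/2⌉≤n n)

module Counting (n₁ n₂ n₃ n₄ : ℕ) (L : OnGrid (List ℕ)) (l : ∀ x₁ x₂ x₃ x₄ → ListOf4 (L x₁ x₂ x₃ x₄))
  (k : OnGrid ℕ) (k∈L : ∀ x₁ x₂ x₃ x₄ → k x₁ x₂ x₃ x₄ ∈ L x₁ x₂ x₃ x₄) where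

  open Colouring n₁ n₂ n₃ n₄ L l k k∈L
  open Tiles n₁ n₂ n₃ n₄

  tile-few : OnGrid Bool
  tile-few t₁ t₂ t₃ t₄ = few (layered n₁ t₁) (layered n₂ t₂) (layered n₃ t₃) (layered n₄ t₄)

  byTile-place : ∀ {A} (f : OnGrid (Tesseract A)) t₁ t₂ t₃ t₄ a b c d →
    onTile (byTile f) t₁ t₂ t₃ t₄ a b c d ≡ f t₁ t₂ t₃ t₄ a b c d
  byTile-place f t₁ t₂ t₃ t₄ a b c d
    rewrite half-place t₁ a | half-place t₂ b | half-place t₃ c | half-place t₄ d
          | even-place t₁ a | even-place t₂ b | even-place t₃ c | even-place t₄ d = refl

  tile-total-cong : ∀ t₁ t₂ t₃ t₄ {f g : Tesseract ℕ} → (∀ a b c d → f a b c d ≡ g a b c d) →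
    tile-total t₁ t₂ t₃ t₄ f ≡ tile-total t₁ t₂ t₃ t₄ g
  tile-total-cong t₁ t₂ t₃ t₄ e = layers-cong (layered n₁ t₁) λ a → layers-cong (layered n₂ t₂) λ b →
    layers-cong (layered n₃ t₃) λ c → layers-cong (layered n₄ t₄) λ d → e a b c d

  -- Tiles that keep `k` are counted as empty here and in `one`; their vertices are counted
  -- separately.
  in-class : ℕ → OnGrid (Tesseract ℕ)
  in-class e t₁ t₂ t₃ t₄ a b c d = if tile-few t₁ t₂ t₃ t₄ then 0 else [ tile-final t₁ t₂ t₃ t₄ a b c d ≈ e ]

  one : OnGrid (Tesseract ℕ)
  one t₁ t₂ t₃ t₄ a b c d = if tile-few t₁ t₂ t₃ t₄ then 0 else 1

  fair-tile : ∀ e t₁ t₂ t₃ t₄ → t₁ < ⌈ n₁ /2⌉ → t₂ < ⌈ n₂ /2⌉ → t₃ < ⌈ n₃ /2⌉ → t₄ < ⌈ n₄ /2⌉ →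
    4 * tile-total t₁ t₂ t₃ t₄ (in-class e t₁ t₂ t₃ t₄) ≤ tile-total t₁ t₂ t₃ t₄ (one t₁ t₂ t₃ t₄)
  fair-tile e t₁ t₂ t₃ t₄ p₁ p₂ p₃ p₄ with tile-few t₁ t₂ t₃ t₄ in eq
  ... | true = ≤-trans (≤-reflexive (cong (4 *_) (layers-zero (layered n₁ t₁) (layers-zero (layered n₂ t₂)
    (layers-zero (layered n₃ t₃) (layers-zero (layered n₄ t₄) refl)))))) z≤n
  ... | false rewrite tile-final-solution t₁ t₂ t₃ t₄
    (+-mono-≤ (<⌈/2⌉⇒≤ p₁) (+-mono-≤ (<⌈/2⌉⇒≤ p₂) (+-mono-≤ (<⌈/2⌉⇒≤ p₃) (<⌈/2⌉⇒≤ p₄)))) =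
    TileSolution.fair (tile-solution (size ∸ depth t₁ t₂ t₃ t₄) t₁ t₂ t₃ t₄) eq e

  fair-range : ∀ e → 4 * range₄ n₁ n₂ n₃ n₄ (byTile (in-class e)) ≤ range₄ n₁ n₂ n₃ n₄ (byTile one)
  fair-range e = begin
    4 * range₄ n₁ n₂ n₃ n₄ (byTile (in-class e))
      ≡⟨ cong (4 *_) (trans (range₄-tiles _) (range₄-cong h₁ h₂ h₃ h₄ (λ t₁ t₂ t₃ t₄ →
           tile-total-cong t₁ t₂ t₃ t₄ (byTile-place (in-class e) t₁ t₂ t₃ t₄)))) ⟩
    4 * range₄ h₁ h₂ h₃ h₄ (λ t₁ t₂ t₃ t₄ → tile-total t₁ t₂ t₃ t₄ (in-class e t₁ t₂ t₃ t₄))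
      ≤⟨ (range-4* h₁ λ t₁ p₁ → range-4* h₂ λ t₂ p₂ → range-4* h₃ λ t₃ p₃ → range-4* h₄ λ t₄ p₄ →
           fair-tile e t₁ t₂ t₃ t₄ p₁ p₂ p₃ p₄) ⟩
    range₄ h₁ h₂ h₃ h₄ (λ t₁ t₂ t₃ t₄ → tile-total t₁ t₂ t₃ t₄ (one t₁ t₂ t₃ t₄))
      ≡⟨ trans (range₄-tiles _) (range₄-cong h₁ h₂ h₃ h₄ (λ t₁ t₂ t₃ t₄ →
           tile-total-cong t₁ t₂ t₃ t₄ (byTile-place one t₁ t₂ t₃ t₄))) ⟨
    range₄ n₁ n₂ n₃ n₄ (byTile one) ∎
    where
    open ≤-Reasoning
    h₁ = ⌈ n₁ /2⌉
    h₂ = ⌈ n₂ /2⌉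
    h₃ = ⌈ n₃ /2⌉
    h₄ = ⌈ n₄ /2⌉

  onTile-halves : ∀ {A : Set} (f : OnGrid A) x₁ x₂ x₃ x₄ →
    byTile (onTile f) x₁ x₂ x₃ x₄ ≡ f x₁ x₂ x₃ x₄
  onTile-halves f x₁ x₂ x₃ x₄ rewrite place-halves x₁ | place-halves x₂ | place-halves x₃ | place-halves x₄ = refl

  module _ {x₁ x₂ x₃ x₄ : ℕ} (x∈ : Inside x₁ x₂ x₃ x₄) where

    open Inside x∈

    private
      solution = tile-solution (size ∸ depth ⌊ x₁ /2⌋ ⌊ x₂ /2⌋ ⌊ x₃ /2⌋ ⌊ x₄ /2⌋) ⌊ x₁ /2⌋ ⌊ x₂ /2⌋ ⌊ x₃ /2⌋ ⌊ x₄ /2⌋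

      colouring-solution : colouring x₁ x₂ x₃ x₄ ≡ TileSolution.γ solution (even x₁) (even x₂) (even x₃) (even x₄)
      colouring-solution = cong (λ γ → γ (even x₁) (even x₂) (even x₃) (even x₄))
        (tile-final-solution ⌊ x₁ /2⌋ ⌊ x₂ /2⌋ ⌊ x₃ /2⌋ ⌊ x₄ /2⌋ (depth≤size x∈))

    colouring-allowed : colouring x₁ x₂ x₃ x₄ ∈ L x₁ x₂ x₃ x₄
    colouring-allowed = subst₂ _∈_ (sym colouring-solution) (onTile-halves L x₁ x₂ x₃ x₄)
      (TileSolution.allowed solution (real x₁ x₁<n₁) (real x₂ x₂<n₂) (real x₃ x₃<n₃) (real x₄ x₄<n₄))

    colouring-kept : tile-few ⌊ x₁ /2⌋ ⌊ x₂ /2⌋ ⌊ x₃ /2⌋ ⌊ x₄ /2⌋ ≡ true → colouring x₁ x₂ x₃ x₄ ≡ k x₁ x₂ x₃ x₄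
    colouring-kept f = trans colouring-solution (trans
      (TileSolution.kept solution f (real x₁ x₁<n₁) (real x₂ x₂<n₂) (real x₃ x₃<n₃) (real x₄ x₄<n₄))
      (onTile-halves k x₁ x₂ x₃ x₄))

-- A left inverse of `toℕ` with the last index as default; it lets list assignments be read at all
-- natural coordinates.
clamp : ∀ n → ℕ → Fin (suc n)
clamp n       zero    = zero
clamp zero    (suc _) = zero
clamp (suc n) (suc x) = suc (clamp n x)

clamp-toℕ : ∀ {n} (i : Fin (suc n)) → clamp n (toℕ i) ≡ i
clamp-toℕ zero            = refl
clamp-toℕ {suc n} (suc i) = cong suc (clamp-toℕ i)

at-point : ∀ {a} {A : Set a} {n₁ n₂ n₃ n₄} → (ℕ → ℕ → ℕ → ℕ → A) → V (Grid4 n₁ n₂ n₃ n₄) → A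
at-point f (i₁ , i₂ , i₃ , i₄) = f (toℕ i₁) (toℕ i₂) (toℕ i₃) (toℕ i₄)

total-product : ∀ {B : Set} n (f : Fin n × B → ℕ) ys (g : ℕ → ℕ) → (∀ i → total (λ y → f (i , y)) ys ≡ g (toℕ i)) →
  total f (cartesianProduct (allFin n) ys) ≡ range n g
total-product n f ys g e = trans (total-cartesianProduct f (allFin n) ys)
  (trans (total-cong (All.universal e (allFin n))) (total-allFin n g))

total-grid : ∀ n₁ n₂ n₃ n₄ f → total (at-point f) (verts (Grid4 n₁ n₂ n₃ n₄)) ≡ range₄ n₁ n₂ n₃ n₄ f
total-grid n₁ n₂ n₃ n₄ f = total-product n₁ _ _ _ λ i₁ → total-product n₂ _ _ _ λ i₂ → total-product n₃ _ _ _ λ i₃ →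
  total-allFin n₄ (f (toℕ i₁) (toℕ i₂) (toℕ i₃))

-- Assembling the colouring

module Assembly (n₁ n₂ n₃ n₄ : ℕ) (vertex : OnGrid (V (Grid4 n₁ n₂ n₃ n₄))) (vertex-at : ∀ v → at-point vertex v ≡ v)
  (lists : V (Grid4 n₁ n₂ n₃ n₄) → List Colour) (uniform : IsUniformListAssignment (Grid4 n₁ n₂ n₃ n₄) 4 lists) where

  G : Graph
  G = Grid4 n₁ n₂ n₃ n₄

  toPoint : V G → Point
  toPoint (i₁ , i₂ , i₃ , i₄) = toℕ i₁ , toℕ i₂ , toℕ i₃ , toℕ i₄

  toPoint-injective : ∀ {v w} → toPoint v ≡ toPoint w → v ≡ w
  toPoint-injective {v} {w} e = trans (sym (vertex-at v))
    (trans (cong (λ { (x₁ , x₂ , x₃ , x₄) → vertex x₁ x₂ x₃ x₄ }) e) (vertex-at w))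

  few-at : V G → Bool
  few-at = at-point λ x₁ x₂ x₃ x₄ → few (layered n₁ ⌊ x₁ /2⌋) (layered n₂ ⌊ x₂ /2⌋)
    (layered n₃ ⌊ x₃ /2⌋) (layered n₄ ⌊ x₄ /2⌋)

  open Chunks (≡-dec Fin._≟_ (≡-dec Fin._≟_ (≡-dec Fin._≟_ Fin._≟_))) lists uniform using (class; chunked)

  verts-unique : Unique (verts G)
  verts-unique = cartesianProduct⁺ (allFin⁺ _) (cartesianProduct⁺ (allFin⁺ _) (cartesianProduct⁺ (allFin⁺ _) (allFin⁺ _)))

  -- The vertices of all tiles that are single vertices or edges. Grouping them across tiles keeps
  -- the total rounding loss at 3.
  spine = filter (T? ∘ few-at) (verts G)
  spine-colouring = chunked spine (filter⁺ (T? ∘ few-at) verts-unique)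
  k = proj₁ spine-colouring

  open Colouring n₁ n₂ n₃ n₄ (λ x₁ x₂ x₃ x₄ → lists (vertex x₁ x₂ x₃ x₄))
    (λ _ _ _ _ → uniform _) (λ x₁ x₂ x₃ x₄ → k (vertex x₁ x₂ x₃ x₄)) (λ _ _ _ _ → proj₁ (proj₂ spine-colouring) _)
  open Counting n₁ n₂ n₃ n₄ (λ x₁ x₂ x₃ x₄ → lists (vertex x₁ x₂ x₃ x₄))
    (λ _ _ _ _ → uniform _) (λ x₁ x₂ x₃ x₄ → k (vertex x₁ x₂ x₃ x₄)) (λ _ _ _ _ → proj₁ (proj₂ spine-colouring) _)

  c : V G → Colour
  c = at-point colouring

  vertex-inside : ∀ v → at-point Inside v
  vertex-inside (i₁ , i₂ , i₃ , i₄) = inside (Fin.toℕ<n i₁) (Fin.toℕ<n i₂) (Fin.toℕ<n i₃) (Fin.toℕ<n i₄)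

  c-allowed : IsLColouring G lists c
  c-allowed v = subst (λ w → c v ∈ lists w) (vertex-at v) (colouring-allowed (vertex-inside v))

  Adj-sym : ∀ {v w} → Adj G v w → Adj G w v
  Adj-sym (inj₁ (p , e)) = inj₁ (swap p , sym e)
  Adj-sym (inj₂ (e , inj₁ (p , e′))) = inj₂ (sym e , inj₁ (swap p , sym e′))
  Adj-sym (inj₂ (e , inj₂ (e′ , inj₁ (p , e″)))) = inj₂ (sym e , inj₂ (sym e′ , inj₁ (swap p , sym e″)))
  Adj-sym (inj₂ (e , inj₂ (e′ , inj₂ (e″ , p)))) = inj₂ (sym e , inj₂ (sym e′ , inj₂ (sym e″ , swap p)))

  find : ∀ v w → Adj G v w → at-point key w ≤ at-point key v → c w ≡ c v → at-point Found v (toPoint w)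
  find v@(i₁ , i₂ , i₃ , i₄) (j₁ , _) (inj₁ (p , refl)) =
    find₁ (vertex-inside v) (move _ _ (Fin.toℕ<n i₁) (Fin.toℕ<n j₁) p)
  find v@(i₁ , i₂ , i₃ , i₄) (_ , j₂ , _) (inj₂ (refl , inj₁ (p , refl))) =
    find₂ (vertex-inside v) (move _ _ (Fin.toℕ<n i₂) (Fin.toℕ<n j₂) p)
  find v@(i₁ , i₂ , i₃ , i₄) (_ , _ , j₃ , _) (inj₂ (refl , inj₂ (refl , inj₁ (p , refl)))) =
    find₃ (vertex-inside v) (move _ _ (Fin.toℕ<n i₃) (Fin.toℕ<n j₃) p)
  find v@(i₁ , i₂ , i₃ , i₄) (_ , _ , _ , j₄) (inj₂ (refl , inj₂ (refl , inj₂ (refl , p)))) =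
    find₄ (vertex-inside v) (move _ _ (Fin.toℕ<n i₄) (Fin.toℕ<n j₄) p)

  -- Two neighbours as in `sparse⇒acyclic` give two items of one colour, hence one tag and one
  -- point.
  c-acyclic : ClassesAcyclic G c
  c-acyclic = sparse⇒acyclic G (λ {v} {w} → Adj-sym {v} {w}) c (at-point key) λ {v} {w} {w′} v~w v~w′ w≤v w′≤v cw cw′ →
    same v w w′ (find v w v~w w≤v cw) (find v w′ v~w′ w′≤v cw′)
    where
    same : ∀ v w w′ → at-point Found v (toPoint w) → at-point Found v (toPoint w′) → w ≡ w′
    same v w w′ (tag , p , e) (tag′ , p′ , e′) with atMostOnce-unique (nearby-once (vertex-inside v)) p p′
    ... | refl = toPoint-injective (trans e (sym e′))

  on-spine off-spine : (V G → ℕ) → V G → ℕ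
  on-spine  f v = if few-at v then f v else 0
  off-spine f v = if few-at v then 0 else f v

  split-spine : ∀ f → total f (verts G) ≡ total (on-spine f) (verts G) + total (off-spine f) (verts G)
  split-spine f = trans (total-cong (All.universal pointwise (verts G))) (total-+ (on-spine f) (off-spine f) (verts G))
    where
    pointwise : ∀ v → f v ≡ on-spine f v + off-spine f v
    pointwise v with few-at v
    ... | true  = sym (+-identityʳ (f v))
    ... | false = refl

  spine-bound : ∀ e → 4 * total (on-spine (λ v → [ c v ≈ e ])) (verts G) ≤ total (on-spine (λ _ → 1)) (verts G) + 3
  spine-bound e = begin
    4 * total (on-spine (λ v → [ c v ≈ e ])) (verts G) ≡⟨ cong (4 *_) (total-cong (All.universal kept (verts G))) ⟩
    4 * total (on-spine (λ v → [ k v ≈ e ])) (verts G) ≡⟨ cong (4 *_) (total-filter few-at (λ v → [ k v ≈ e ]) (verts G)) ⟨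
    4 * class k e spine                                ≤⟨ proj₂ (proj₂ spine-colouring) e ⟩
    length spine + 3                                   ≡⟨ cong (_+ 3) (total-one spine) ⟨
    total (λ _ → 1) spine + 3                          ≡⟨ cong (_+ 3) (total-filter few-at (λ _ → 1) (verts G)) ⟩
    total (on-spine (λ _ → 1)) (verts G) + 3           ∎
    where
    open ≤-Reasoning
    kept : ∀ v → on-spine (λ v → [ c v ≈ e ]) v ≡ on-spine (λ v → [ k v ≈ e ]) v
    kept v with few-at v in eq
    ... | true  = cong (λ z → [ z ≈ e ]) (trans (colouring-kept (vertex-inside v) eq) (cong k (vertex-at v)))
    ... | false = refl

  -- The spine contributes its share with an excess of 3, the other tiles theirs with none.
  class-bound : ∀ e → 4 * classSize G c e ≤ order G + 3
  class-bound e = begin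
    4 * classSize G c e
      ≡⟨ cong (4 *_) (trans (length-filter-total c e (verts G)) (split-spine (λ v → [ c v ≈ e ]))) ⟩
    4 * (total (on-spine (λ v → [ c v ≈ e ])) (verts G) + total (off-spine (λ v → [ c v ≈ e ])) (verts G))
      ≡⟨ *-distribˡ-+ 4 (total (on-spine (λ v → [ c v ≈ e ])) (verts G)) _ ⟩
    4 * total (on-spine (λ v → [ c v ≈ e ])) (verts G) + 4 * total (off-spine (λ v → [ c v ≈ e ])) (verts G)
      -- The summands off the spine are, by evaluation, those of `byTile (in-class e)`.
      ≡⟨ cong (λ z → 4 * total (on-spine (λ v → [ c v ≈ e ])) (verts G) + 4 * z) (total-grid n₁ n₂ n₃ n₄ (byTile (in-class e))) ⟩
    4 * total (on-spine (λ v → [ c v ≈ e ])) (verts G) + 4 * range₄ n₁ n₂ n₃ n₄ (byTile (in-class e))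
      ≤⟨ +-mono-≤ (spine-bound e) (fair-range e) ⟩
    total (on-spine (λ _ → 1)) (verts G) + 3 + range₄ n₁ n₂ n₃ n₄ (byTile one)
      ≡⟨ cong (total (on-spine (λ _ → 1)) (verts G) + 3 +_) (total-grid n₁ n₂ n₃ n₄ (byTile one)) ⟨
    total (on-spine (λ _ → 1)) (verts G) + 3 + total (off-spine (λ _ → 1)) (verts G)
      ≡⟨ xy∙z≈xz∙y (total (on-spine (λ _ → 1)) (verts G)) 3 _ ⟩
    total (on-spine (λ _ → 1)) (verts G) + total (off-spine (λ _ → 1)) (verts G) + 3
      ≡⟨ cong (_+ 3) (split-spine (λ _ → 1)) ⟨
    total (λ _ → 1) (verts G) + 3
      ≡⟨ cong (_+ 3) (total-one (verts G)) ⟩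
    order G + 3 ∎
    where
    open ≤-Reasoning

  -- For four colours `ceilDiv` divides the order plus 3 by 4, so `class-bound` only has to be
  -- divided by 4.
  c-equitable : IsEquitable G 4 c
  c-equitable e = begin
    classSize G c e         ≡⟨ m*n/n≡m (classSize G c e) 4 ⟨
    classSize G c e * 4 / 4 ≤⟨ /-monoˡ-≤ 4 (≤-trans (≤-reflexive (*-comm (classSize G c e) 4)) (class-bound e)) ⟩
    (order G + 3) / 4       ∎
    where open ≤-Reasoning

theorem12 : (n₁ n₂ n₃ n₄ : ℕ) → 2 ≤ n₁ → 2 ≤ n₂ → 2 ≤ n₃ → 2 ≤ n₄ →
    EquitablyListArborable (Grid4 n₁ n₂ n₃ n₄) 4
theorem12 (suc m₁) (suc m₂) (suc m₃) (suc m₄) _ _ _ _ lists uniform = c , c-allowed , c-equitable , c-acyclic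
  where
  vertex : OnGrid (V (Grid4 (suc m₁) (suc m₂) (suc m₃) (suc m₄)))
  vertex x₁ x₂ x₃ x₄ = clamp m₁ x₁ , clamp m₂ x₂ , clamp m₃ x₃ , clamp m₄ x₄

  vertex-at : ∀ v → at-point vertex v ≡ v
  vertex-at (i₁ , i₂ , i₃ , i₄) =
    cong₂ _,_ (clamp-toℕ i₁) (cong₂ _,_ (clamp-toℕ i₂) (cong₂ _,_ (clamp-toℕ i₃) (clamp-toℕ i₄)))

  open Assembly (suc m₁) (suc m₂) (suc m₃) (suc m₄) vertex vertex-at lists uniform
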